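{- (Hereditary substitution respects typing.) Let $\Sigma$ be a CoLF signature with $\Sigma\ \mathsf{sig}$. If $\Gamma\vdash_{\Xi;\Sigma}N\Leftarrow A$ and $\Gamma,x{:}A,\Gamma'\vdash_{\Xi;\Sigma}M\Leftarrow B$, then $\Gamma,[N/x]^{A^o}\Gamma'\vdash_{\Xi;\Sigma}[N/x]^{A^o}M\Leftarrow[N/x]^{A^o}B$.
   Context: CoLF syntax: signatures contain $a:K$, $c:A$, $r:A=M$; contexts $\Gamma::=\cdot\mid\Gamma,x{:}A\mid\Gamma,x\,\hat{:}\,A$ (the latter a prepattern variable); kinds $K::=\mathsf{type}\mid\mathsf{cotype}\mid\Pi x{:}A.K\mid\Pi x\,\hat{:}\,A.K$; types $A::=a\cdot S\mid\Pi x{:}A_2.A_1\mid\Pi x\,\hat{:}\,A_2.A_1$; terms $M::=H\cdot S\mid\lambda x.M$, $H::=x\mid c\mid r$; spines $S::=()\mid M;S\mid[y];S$. Erasure: $(\Pi x{:}A_2.A_1)^o=A_2^o\to A_1^o$, $(\Pi x\,\hat{:}\,A_2.A_1)^o=*\to A_1^o$, atomic types erase to $*$. Renaming $\{y/x\}$ and hereditary substitution $[N/x]^\tau$ (partial, extended homomorphically to kinds, types, contexts): $[N/x]^\tau(x\cdot S)=([N/x]^\tau S)\rhd^\tau N$, $[N/x]^\tau(H\cdot S)=H\cdot[N/x]^\tau S$ for $H\neq x$, $[N/x]^\tau([x];S)$ undefined, $[N/x]^\tau([z];S)=[z];[N/x]^\tau S$; $()\rhd^*R=R$, $(N;S)\rhd^{\tau_2\to\tau_1}(\lambda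 x.M)=S\rhd^{\tau_1}([N/x]^{\tau_2}M)$, $([y];S)\rhd^{*\to\tau_1}(\lambda x.M)=S\rhd^{\tau_1}(\{y/x\}M)$. Typing (bidirectional, parametrised by a checked local prefix $\Xi$ of the global signature $\Sigma$): $\lambda x.M\Leftarrow\Pi x{:}A_2.A_1$ (resp. $\Pi x\,\hat{:}\,A_2.A_1$) if $\Gamma,x{:}A_2\vdash M\Leftarrow A_1$ (resp. $\Gamma,x\,\hat{:}\,A_2$); $R\Leftarrow P$ if $R\Rightarrow P'$ and $P'=P$; $H\cdot S\Rightarrow P$ if $H$ has type $A$ (from $\Gamma$, from a constructor in $\Xi$, or a recursion constant in $\Xi$ — or in $\Sigma$ while checking bodies of recursive definitions) and $S\rhd A\Rightarrow P$; spine typing: $()\rhd P\Rightarrow P$; $M;S\rhd\Pi x{:}A_2.A_1\Rightarrow P$ if $M\Leftarrow A_2$ and $S\rhd[M/x]^{A_2^o}A_1\Rightarrow P$; $[y];S\rhd\Pi x\,\hat{:}\,A_2.A_1\Rightarrow P$ if $y\,\hat{:}\,A_2'\in\Gamma$, $A_2'=A_2$ and $S\rhd\{y/x\}A_1\Rightarrow P$. Type equality $a\cdot S=a\cdot S'$ holds iff $\cdot;|\Gamma|\vdash_\Sigma S=S'$ in the CoLF term equality (equality of the infinite Böhm-tree unfoldings), extended structurally to $\Pi$-types; kinds and types are checked analogously, atomic $a\cdot S$ synthesising its kind via $a:K\in\Xi$ and spine application. $\Sigma\ \mathsf{sig}$ means every declaration is well-formed in this sense in order (kinds and types checked against earlier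 declarations), every recursion declaration $r:A=M$ has $A$ consisting only of prepattern $\Pi$'s, $M$ contractive (head not a recursion constant), all occurrences of $r$ in $M$ guarded by a coinductive constructor of highest priority on the trace (priority: type families declared later have higher priority; a constructor is coinductive if its target family has kind ending in $\mathsf{cotype}$), and every body $M$ checks against $A$. -}

module Defs where

open import Data.Nat using (ℕ; zero; suc; _+_; _∸_; _≤_; _<ᵇ_; _≡ᵇ_)
open import Data.Bool using (Bool; if_then_else_)
open import Data.List using (List; []; _∷_; _++_; length)
open import Data.List.Membership.Propositional using (_∈_)
open import Data.List.Relation.Unary.All using (All)
open import Data.Maybe using (Maybe; just; nothing; _>>=_; map)
open import Data.Product using (Σ; ∃; ∃-syntax; _×_; _,_)
open import Data.Sum using (_⊎_)
open import Relation.Binary.PropositionalEquality using (_≡_; _≢_)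

-- Syntax of CoLF (locally nameless: bound/free variables are de Bruijn
-- indices; constants are named by natural numbers).

data Head : Set where
  var : ℕ → Head
  con : ℕ → Head
  rec : ℕ → Head

mutual
  data Tm : Set where
    _·_ : Head → Sp → Tm
    lam : Tm → Tm

  data Sp : Set where
    ε     : Sp
    _∷_   : Tm → Sp → Sp
    [_]∷_ : ℕ → Sp → Sp

infixr 5 _∷_ [_]∷_

data Ty : Set where
  atom : ℕ → Sp → Ty
  Πt   : Ty → Ty → Ty
  Πp   : Ty → Ty → Ty     -- Π x ^: A₂. A₁ (prepattern Π)

data Ki : Set where
  type   : Ki
  cotype : Ki
  Πk     : Ty → Ki → Ki
  Πkp    : Ty → Ki → Ki

data Decl : Set where
  fam  : ℕ → Ki → Decl
  cst  : ℕ → Ty → Decl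
  rdef : ℕ → Ty → Tm → Decl

-- Signatures: oldest declaration first.
Sig : Set
Sig = List Decl

declName : Decl → ℕ
declName (fam a _) = a
declName (cst c _) = c
declName (rdef r _ _) = r

data Entry : Set where
  ord : Ty → Entry
  pre : Ty → Entry

-- Contexts: newest entry first (index 0 = most recent variable).
-- So  Γ, x:A, Γ'  is written  Γ' ++ ord A ∷ Γ.
Ctx : Set
Ctx = List Entry

entryTy : Entry → Ty
entryTy (ord A) = A
entryTy (pre A) = A

data STy : Set where
  *   : STy
  _⇒_ : STy → STy → STy

erase : Ty → STy
erase (atom _ _) = *
erase (Πt A₂ A₁) = erase A₂ ⇒ erase A₁
erase (Πp A₂ A₁) = * ⇒ erase A₁

shiftVar : ℕ → ℕ → ℕ → ℕ
shiftVar c d i = if i <ᵇ c then i else i + d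

shiftH : ℕ → ℕ → Head → Head
shiftH c d (var i) = var (shiftVar c d i)
shiftH c d (con k) = con k
shiftH c d (rec k) = rec k

mutual
  shiftTm : ℕ → ℕ → Tm → Tm
  shiftTm c d (H · S) = shiftH c d H · shiftSp c d S
  shiftTm c d (lam M) = lam (shiftTm (suc c) d M)

  shiftSp : ℕ → ℕ → Sp → Sp
  shiftSp c d ε = ε
  shiftSp c d (M ∷ S) = shiftTm c d M ∷ shiftSp c d S
  shiftSp c d ([ y ]∷ S) = [ shiftVar c d y ]∷ shiftSp c d S

shiftTy : ℕ → ℕ → Ty → Ty
shiftTy c d (atom a S) = atom a (shiftSp c d S)
shiftTy c d (Πt A₂ A₁) = Πt (shiftTy c d A₂) (shiftTy (suc c) d A₁)
shiftTy c d (Πp A₂ A₁) = Πp (shiftTy c d A₂) (shiftTy (suc c) d A₁)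

shiftEntry : ℕ → ℕ → Entry → Entry
shiftEntry c d (ord A) = ord (shiftTy c d A)
shiftEntry c d (pre A) = pre (shiftTy c d A)

-- Renaming {y/x}: replace index k by variable y (a variable of the
-- context outside the k binders), and remove index k.

renVar : ℕ → ℕ → ℕ → ℕ
renVar y k i = if i <ᵇ k then i else (if i ≡ᵇ k then y + k else i ∸ 1)

renH : ℕ → ℕ → Head → Head
renH y k (var i) = var (renVar y k i)
renH y k (con c) = con c
renH y k (rec r) = rec r

mutual
  renTm : ℕ → ℕ → Tm → Tm
  renTm y k (H · S) = renH y k H · renSp y k S
  renTm y k (lam M) = lam (renTm y (suc k) M)

  renSp : ℕ → ℕ → Sp → Sp
  renSp y k ε = ε
  renSp y k (M ∷ S) = renTm y k M ∷ renSp y k S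
  renSp y k ([ z ]∷ S) = [ renVar y k z ]∷ renSp y k S

renTy : ℕ → ℕ → Ty → Ty
renTy y k (atom a S) = atom a (renSp y k S)
renTy y k (Πt A₂ A₁) = Πt (renTy y k A₂) (renTy y (suc k) A₁)
renTy y k (Πp A₂ A₁) = Πp (renTy y k A₂) (renTy y (suc k) A₁)

renKi : ℕ → ℕ → Ki → Ki
renKi y k type = type
renKi y k cotype = cotype
renKi y k (Πk A K) = Πk (renTy y k A) (renKi y (suc k) K)
renKi y k (Πkp A K) = Πkp (renTy y k A) (renKi y (suc k) K)

-- Hereditary substitution [N/x]^τ, partial (Maybe).
-- substTm τ N k M : substitute N (a term of the context outside the k
-- binders) for index k in M, removing index k.
-- reduce τ S R    : S ▷^τ R.

_<*>_ : {A B : Set} → Maybe (A → B) → Maybe A → Maybe B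
mf <*> mx = mf >>= λ f → map f mx

infixl 4 _<*>_

mutual
  substTm : STy → Tm → ℕ → Tm → Maybe Tm
  substTm τ N k (lam M) = map lam (substTm τ N (suc k) M)
  substTm τ N k (var i · S) =
    if i <ᵇ k then map (var i ·_) (substSp τ N k S)
    else if i ≡ᵇ k then (substSp τ N k S >>= λ S' → reduce τ S' (shiftTm 0 k N))
    else map (var (i ∸ 1) ·_) (substSp τ N k S)
  substTm τ N k (con c · S) = map (con c ·_) (substSp τ N k S)
  substTm τ N k (rec r · S) = map (rec r ·_) (substSp τ N k S)

  substSp : STy → Tm → ℕ → Sp → Maybe Sp
  substSp τ N k ε = just ε
  substSp τ N k (M ∷ S) = just _∷_ <*> substTm τ N k M <*> substSp τ N k S
  substSp τ N k ([ z ]∷ S) =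
    if z <ᵇ k then map ([ z ]∷_) (substSp τ N k S)
    else if z ≡ᵇ k then nothing
    else map ([ z ∸ 1 ]∷_) (substSp τ N k S)

  reduce : STy → Sp → Tm → Maybe Tm
  reduce * ε R = just R
  reduce (τ₂ ⇒ τ₁) (M ∷ S) (lam B) = substTm τ₂ M 0 B >>= reduce τ₁ S
  reduce (* ⇒ τ₁) ([ y ]∷ S) (lam B) = reduce τ₁ S (renTm y 0 B)
  reduce _ _ _ = nothing

substTy : STy → Tm → ℕ → Ty → Maybe Ty
substTy τ N k (atom a S) = map (atom a) (substSp τ N k S)
substTy τ N k (Πt A₂ A₁) = just Πt <*> substTy τ N k A₂ <*> substTy τ N (suc k) A₁
substTy τ N k (Πp A₂ A₁) = just Πp <*> substTy τ N k A₂ <*> substTy τ N (suc k) A₁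

substKi : STy → Tm → ℕ → Ki → Maybe Ki
substKi τ N k type = just type
substKi τ N k cotype = just cotype
substKi τ N k (Πk A K) = just Πk <*> substTy τ N k A <*> substKi τ N (suc k) K
substKi τ N k (Πkp A K) = just Πkp <*> substTy τ N k A <*> substKi τ N (suc k) K

substEntry : STy → Tm → ℕ → Entry → Maybe Entry
substEntry τ N k (ord A) = map ord (substTy τ N k A)
substEntry τ N k (pre A) = map pre (substTy τ N k A)

-- [N/x]Γ' for Γ' (newest first) sitting to the right of x : the entry
-- with j older entries of Γ' before it sees x at index j.
substCtx : STy → Tm → Ctx → Maybe Ctx
substCtx τ N [] = just []
substCtx τ N (e ∷ Γ') = just _∷_ <*> substEntry τ N (length Γ') e <*> substCtx τ N Γ'

data _∋_⦂_ : Ctx → ℕ → Entry → Set where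
  here  : ∀ {e Γ} → (e ∷ Γ) ∋ 0 ⦂ shiftEntry 0 1 e
  there : ∀ {e e' Γ i} → Γ ∋ i ⦂ e → (e' ∷ Γ) ∋ suc i ⦂ shiftEntry 0 1 e

-- Term equality: equality of the infinite Böhm-tree unfoldings, given
-- as agreement of all finite-depth truncations.  A recursion constant
-- r · S is unfolded (via its definition r : A = M in Σ) to S ▷^{A°} M.

NotRec : Head → Set
NotRec (var _) = Data.Unit.⊤ where import Data.Unit
NotRec (con _) = Data.Unit.⊤ where import Data.Unit
NotRec (rec _) = Data.Empty.⊥ where import Data.Empty

data Unfold (Sg : Sig) : Head → Sp → Head → Sp → Set where
  var : ∀ {i S} → Unfold Sg (var i) S (var i) S
  con : ∀ {c S} → Unfold Sg (con c) S (con c) S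
  rec : ∀ {r A M S h T} → rdef r A M ∈ Sg →
        reduce (erase A) S M ≡ just (h · T) → NotRec h →
        Unfold Sg (rec r) S h T

mutual
  data EqTm (Sg : Sig) : ℕ → Tm → Tm → Set where
    eq0   : ∀ {M N} → EqTm Sg 0 M N
    eqlam : ∀ {n M N} → EqTm Sg n M N → EqTm Sg n (lam M) (lam N)
    eqhd  : ∀ {n H S H' S' h T T'} →
            Unfold Sg H S h T → Unfold Sg H' S' h T' → EqSp Sg n T T' →
            EqTm Sg (suc n) (H · S) (H' · S')

  data EqSp (Sg : Sig) : ℕ → Sp → Sp → Set where
    eqnil  : ∀ {n} → EqSp Sg n ε ε
    eqcons : ∀ {n M M' S S'} → EqTm Sg n M M' → EqSp Sg n S S' →
             EqSp Sg n (M ∷ S) (M' ∷ S')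
    eqpre  : ∀ {n y S S'} → EqSp Sg n S S' → EqSp Sg n ([ y ]∷ S) ([ y ]∷ S')

SpEq : Sig → Sp → Sp → Set
SpEq Sg S S' = ∀ n → EqSp Sg n S S'

data TyEq (Sg : Sig) : Ty → Ty → Set where
  atom : ∀ {a S S'} → SpEq Sg S S' → TyEq Sg (atom a S) (atom a S')
  Πt   : ∀ {A₂ A₁ B₂ B₁} → TyEq Sg A₂ B₂ → TyEq Sg A₁ B₁ → TyEq Sg (Πt A₂ A₁) (Πt B₂ B₁)
  Πp   : ∀ {A₂ A₁ B₂ B₁} → TyEq Sg A₂ B₂ → TyEq Sg A₁ B₁ → TyEq Sg (Πp A₂ A₁) (Πp B₂ B₁)

-- Typing  Γ ⊢_{Ξ;Σ} ...
-- Mode: 'plain' looks recursion constants up in Ξ; 'body' (used while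
-- checking bodies of recursive definitions) additionally in Σ.

data Mode : Set where
  plain body : Mode

module Typing (m : Mode) (Ξ Sg : Sig) where

  data HeadTy (Γ : Ctx) : Head → Ty → Set where
    hvar  : ∀ {i A} → Γ ∋ i ⦂ ord A → HeadTy Γ (var i) A
    hpvar : ∀ {i A} → Γ ∋ i ⦂ pre A → HeadTy Γ (var i) A
    hcon  : ∀ {c A} → cst c A ∈ Ξ → HeadTy Γ (con c) A
    hrec  : ∀ {r A M} → rdef r A M ∈ Ξ → HeadTy Γ (rec r) A
    hrecΣ : ∀ {r A M} → m ≡ body → rdef r A M ∈ Sg → HeadTy Γ (rec r) A

  mutual
    data Check (Γ : Ctx) : Tm → Ty → Set where
      clam  : ∀ {M A₂ A₁} → Check (ord A₂ ∷ Γ) M A₁ → Check Γ (lam M) (Πt A₂ A₁)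
      clamp : ∀ {M A₂ A₁} → Check (pre A₂ ∷ Γ) M A₁ → Check Γ (lam M) (Πp A₂ A₁)
      catom : ∀ {H S P' a S''} → Synth Γ (H · S) P' → TyEq Sg P' (atom a S'') →
              Check Γ (H · S) (atom a S'')

    data Synth (Γ : Ctx) : Tm → Ty → Set where
      shd : ∀ {H S A P} → HeadTy Γ H A → SpTy Γ S A P → Synth Γ (H · S) P

    data SpTy (Γ : Ctx) : Sp → Ty → Ty → Set where
      snil  : ∀ {a S} → SpTy Γ ε (atom a S) (atom a S)
      scons : ∀ {M S A₂ A₁ A₁' P} → Check Γ M A₂ →
              substTy (erase A₂) M 0 A₁ ≡ just A₁' → SpTy Γ S A₁' P →
              SpTy Γ (M ∷ S) (Πt A₂ A₁) P
      spre  : ∀ {y S A₂ A₂' A₁ P} → Γ ∋ y ⦂ pre A₂' → TyEq Sg A₂' A₂ →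
              SpTy Γ S (renTy y 0 A₁) P → SpTy Γ ([ y ]∷ S) (Πp A₂ A₁) P

  data SpKi (Γ : Ctx) : Sp → Ki → Ki → Set where
    knil  : ∀ {K} → SpKi Γ ε K K
    kcons : ∀ {M S A₂ K K' K''} → Check Γ M A₂ →
            substKi (erase A₂) M 0 K ≡ just K' → SpKi Γ S K' K'' →
            SpKi Γ (M ∷ S) (Πk A₂ K) K''
    kpre  : ∀ {y S A₂ A₂' K K''} → Γ ∋ y ⦂ pre A₂' → TyEq Sg A₂' A₂ →
            SpKi Γ S (renKi y 0 K) K'' → SpKi Γ ([ y ]∷ S) (Πkp A₂ K) K''

  data WfTy (Γ : Ctx) : Ty → Set where
    watom : ∀ {a K S K'} → fam a K ∈ Ξ → SpKi Γ S K K' →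
            (K' ≡ type ⊎ K' ≡ cotype) → WfTy Γ (atom a S)
    wΠt   : ∀ {A₂ A₁} → WfTy Γ A₂ → WfTy (ord A₂ ∷ Γ) A₁ → WfTy Γ (Πt A₂ A₁)
    wΠp   : ∀ {A₂ A₁} → WfTy Γ A₂ → WfTy (pre A₂ ∷ Γ) A₁ → WfTy Γ (Πp A₂ A₁)

  data WfKi (Γ : Ctx) : Ki → Set where
    wtype   : WfKi Γ type
    wcotype : WfKi Γ cotype
    wΠk     : ∀ {A K} → WfTy Γ A → WfKi (ord A ∷ Γ) K → WfKi Γ (Πk A K)
    wΠkp    : ∀ {A K} → WfTy Γ A → WfKi (pre A ∷ Γ) K → WfKi Γ (Πkp A K)

  data WfCtx : Ctx → Set where
    cnil  : WfCtx []
    ccons : ∀ {e Γ} → WfCtx Γ → WfTy Γ (entryTy e) → WfCtx (e ∷ Γ)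

Fresh : ℕ → Sig → Set
Fresh x Ξ = All (λ d → declName d ≢ x) Ξ

data AllPre : Ty → Set where
  pat  : ∀ {a S} → AllPre (atom a S)
  pΠ   : ∀ {A₂ A₁} → AllPre A₁ → AllPre (Πp A₂ A₁)

data Contractive : Tm → Set where
  ctlam : ∀ {M} → Contractive M → Contractive (lam M)
  cthd  : ∀ {H S} → NotRec H → Contractive (H · S)

headCons : Head → List ℕ
headCons (con c) = c ∷ []
headCons _ = []

-- OccTm r M t : an occurrence of r in M whose trace (list of
-- constructors on the path from the root of M) is t.
mutual
  data OccTm (r : ℕ) : Tm → List ℕ → Set where
    olam  : ∀ {M t} → OccTm r M t → OccTm r (lam M) t
    ohere : ∀ {S} → OccTm r (rec r · S) []
    oarg  : ∀ {H S t} → OccSp r S t → OccTm r (H · S) (headCons H ++ t)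

  data OccSp (r : ℕ) : Sp → List ℕ → Set where
    ohd  : ∀ {M S t} → OccTm r M t → OccSp r (M ∷ S) t
    otl  : ∀ {M S t} → OccSp r S t → OccSp r (M ∷ S) t
    otlp : ∀ {y S t} → OccSp r S t → OccSp r ([ y ]∷ S) t

target : Ty → ℕ
target (atom a _) = a
target (Πt _ A) = target A
target (Πp _ A) = target A

kindEnd : Ki → Ki
kindEnd (Πk _ K) = kindEnd K
kindEnd (Πkp _ K) = kindEnd K
kindEnd K = K

data At {A : Set} : List A → ℕ → A → Set where
  at0 : ∀ {x xs} → At (x ∷ xs) 0 x
  atS : ∀ {x y xs p} → At xs p x → At (y ∷ xs) (suc p) x

-- constructor c has target family a, declared at position p (its
-- priority: later declared = higher) with kind K
ConInfo : Sig → ℕ → ℕ → Ki → Set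
ConInfo Sg c p K = ∃[ A ] (cst c A ∈ Sg × At Sg p (fam (target A) K))

Guarded : Sig → ℕ → Tm → Set
Guarded Sg r M = ∀ t → OccTm r M t →
  ∃[ c ] ∃[ p ] ∃[ K ] (c ∈ t × ConInfo Sg c p K × kindEnd K ≡ cotype ×
    (∀ c' p' K' → c' ∈ t → ConInfo Sg c' p' K' → p' ≤ p))

DeclOK : Sig → Sig → Decl → Set
DeclOK Sg Ξ (fam a K) = Fresh a Ξ × Typing.WfKi plain Ξ Sg [] K
DeclOK Sg Ξ (cst c A) = Fresh c Ξ × Typing.WfTy plain Ξ Sg [] A
DeclOK Sg Ξ (rdef r A M) = Fresh r Ξ × Typing.WfTy plain Ξ Sg [] A × AllPre A ×
  Contractive M × Guarded Sg r M × Typing.Check body Ξ Sg [] M A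

SigOK : Sig → Set
SigOK Sg = ∀ Ξ d rest → Sg ≡ Ξ ++ d ∷ rest → DeclOK Sg Ξ d

{-# OPTIONS --safe #-}

-- Erasing the spines inside types, but keeping the distinction between the two
-- kinds of Π, leaves a simple typing that is invariant under substitution and
-- type equality. Simple typing already makes hereditary substitution defined,
-- by induction on the simple type of the variable; wherever two substitutions
-- are defined, they commute.
--
-- Type equality compares infinite unfoldings. It survives substitution because
-- recursion constants take only prepattern arguments: an ordinary variable
-- cannot enter a recursive definition, so it occurs only in the finite part of
-- a term lying above the recursion constants. Hence equality is transported by
-- induction on that finite part, and below it nothing changes but the indices.

module Submission where

open import Defs
open import Data.Bool using (true; false; if_then_else_)
open import Data.Bool.Properties using (if-float)
open import Data.Nat using (ℕ; zero; suc; _∸_; _<ᵇ_; _≡ᵇ_)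
open import Data.Nat.Properties using (+-comm; +-suc; +-identityʳ)
open import Data.List using (List; []; _∷_; _++_; length)
open import Data.Maybe using (Maybe; just; map; _>>=_)
open import Data.Maybe.Properties using (just-injective)
open import Data.Product using (∃-syntax; _×_; _,_; proj₁; proj₂)
open import Data.Sum using (_⊎_; inj₁; inj₂)
open import Relation.Nullary using (¬_)
open import Data.List.Membership.Propositional using (_∈_)
open import Data.List.Membership.Propositional.Properties using (∈-∃++; ∈-++⁺ˡ; ∈-++⁺ʳ)
open import Data.List.Properties using (++-assoc)
open import Data.List.Relation.Unary.All using (lookup)
open import Data.List.Relation.Unary.Any using (here; there)
open import Data.Unit using (tt)
open import Data.Empty using (⊥-elim)
open import Relation.Binary.PropositionalEquality using (_≡_; _≢_; refl; sym; trans; cong; cong₂; subst)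

-- Renaming along arbitrary maps of indices

-- Definedness and preservation of typing look circular: the spine rule mentions an instantiated
-- type, and this instance is only known to exist for well-typed arguments. Simple typing breaks the
-- circle because its rules mention no substitution. Once definedness is settled, the partial
-- function can be traded for its graph, whose derivations contain every reduction that a
-- substitution triggers. Equality and typing are then transported by induction on these
-- derivations. Only definedness and commutation need the types as a measure, because they must
-- construct new derivations. A further obstacle is that even reflexivity of type equality has
-- content: a recursion constant must unfold, and to a head that is not again a recursion constant.
-- The former comes from simple typing, the latter from contractivity.

lift : (ℕ → ℕ) → ℕ → ℕ
lift f zero = zero
lift f (suc i) = suc (f i)

renameH : (ℕ → ℕ) → Head → Head
renameH f (var i) = var (f i)
renameH f (con c) = con c
renameH f (rec r) = rec r

mutual
  renameTm : (ℕ → ℕ) → Tm → Tm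
  renameTm f (H · S) = renameH f H · renameSp f S
  renameTm f (lam M) = lam (renameTm (lift f) M)

  renameSp : (ℕ → ℕ) → Sp → Sp
  renameSp f ε = ε
  renameSp f (M ∷ S) = renameTm f M ∷ renameSp f S
  renameSp f ([ y ]∷ S) = [ f y ]∷ renameSp f S

renameTy : (ℕ → ℕ) → Ty → Ty
renameTy f (atom a S) = atom a (renameSp f S)
renameTy f (Πt A₂ A₁) = Πt (renameTy f A₂) (renameTy (lift f) A₁)
renameTy f (Πp A₂ A₁) = Πp (renameTy f A₂) (renameTy (lift f) A₁)

renameEntry : (ℕ → ℕ) → Entry → Entry
renameEntry f (ord A) = ord (renameTy f A)
renameEntry f (pre A) = pre (renameTy f A)

inst : ℕ → ℕ → ℕ
inst y zero = y
inst y (suc i) = i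

private variable
  f g h f' g' : ℕ → ℕ
  i j k l i' j' k' l' n c d y r a : ℕ
  σ τ : STy
  M M' N N' R R' B B' : Tm
  S S' T T' : Sp
  A A' A₁ A₂ P C : Ty
  e e' : Entry
  H H' : Head
  Γ Δ Θ : Ctx
  Sg : Sig

lift-∘ : (∀ i → f (g i) ≡ h i) → ∀ i → lift f (lift g i) ≡ lift h i
lift-∘ p zero = refl
lift-∘ p (suc i) = cong suc (p i)

lift-id : (∀ i → f i ≡ i) → ∀ i → lift f i ≡ i
lift-id p zero = refl
lift-id p (suc i) = cong suc (p i)

renameH-∘ : (∀ i → f (g i) ≡ h i) → ∀ H → renameH f (renameH g H) ≡ renameH h H
renameH-∘ p (var i) = cong var (p i)
renameH-∘ p (con c) = refl
renameH-∘ p (rec r) = refl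

mutual
  renameTm-∘ : (∀ i → f (g i) ≡ h i) → ∀ M → renameTm f (renameTm g M) ≡ renameTm h M
  renameTm-∘ p (H · S) = cong₂ _·_ (renameH-∘ p H) (renameSp-∘ p S)
  renameTm-∘ p (lam M) = cong lam (renameTm-∘ (lift-∘ p) M)

  renameSp-∘ : (∀ i → f (g i) ≡ h i) → ∀ S → renameSp f (renameSp g S) ≡ renameSp h S
  renameSp-∘ p ε = refl
  renameSp-∘ p (M ∷ S) = cong₂ _∷_ (renameTm-∘ p M) (renameSp-∘ p S)
  renameSp-∘ p ([ y ]∷ S) = cong₂ [_]∷_ (p y) (renameSp-∘ p S)

renameTy-∘ : (∀ i → f (g i) ≡ h i) → ∀ A → renameTy f (renameTy g A) ≡ renameTy h A
renameTy-∘ p (atom a S) = cong (atom a) (renameSp-∘ p S)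
renameTy-∘ p (Πt A₂ A₁) = cong₂ Πt (renameTy-∘ p A₂) (renameTy-∘ (lift-∘ p) A₁)
renameTy-∘ p (Πp A₂ A₁) = cong₂ Πp (renameTy-∘ p A₂) (renameTy-∘ (lift-∘ p) A₁)

renameH-id : (∀ i → f i ≡ i) → ∀ H → renameH f H ≡ H
renameH-id p (var i) = cong var (p i)
renameH-id p (con c) = refl
renameH-id p (rec r) = refl

mutual
  renameTm-id : (∀ i → f i ≡ i) → ∀ M → renameTm f M ≡ M
  renameTm-id p (H · S) = cong₂ _·_ (renameH-id p H) (renameSp-id p S)
  renameTm-id p (lam M) = cong lam (renameTm-id (lift-id p) M)

  renameSp-id : (∀ i → f i ≡ i) → ∀ S → renameSp f S ≡ S
  renameSp-id p ε = refl
  renameSp-id p (M ∷ S) = cong₂ _∷_ (renameTm-id p M) (renameSp-id p S)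
  renameSp-id p ([ y ]∷ S) = cong₂ [_]∷_ (p y) (renameSp-id p S)

renameTy-id : (∀ i → f i ≡ i) → ∀ A → renameTy f A ≡ A
renameTy-id p (atom a S) = cong (atom a) (renameSp-id p S)
renameTy-id p (Πt A₂ A₁) = cong₂ Πt (renameTy-id p A₂) (renameTy-id (lift-id p) A₁)
renameTy-id p (Πp A₂ A₁) = cong₂ Πp (renameTy-id p A₂) (renameTy-id (lift-id p) A₁)

renameTm-square : (∀ i → f (g i) ≡ f' (g' i)) → ∀ M →
  renameTm f (renameTm g M) ≡ renameTm f' (renameTm g' M)
renameTm-square p M = trans (renameTm-∘ p M) (sym (renameTm-∘ (λ _ → refl) M))

renameTy-square : (∀ i → f (g i) ≡ f' (g' i)) → ∀ A →
  renameTy f (renameTy g A) ≡ renameTy f' (renameTy g' A)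
renameTy-square p A = trans (renameTy-∘ p A) (sym (renameTy-∘ (λ _ → refl) A))

renameEntry-square : (∀ i → f (g i) ≡ f' (g' i)) → ∀ e →
  renameEntry f (renameEntry g e) ≡ renameEntry f' (renameEntry g' e)
renameEntry-square p (ord A) = cong ord (renameTy-square p A)
renameEntry-square p (pre A) = cong pre (renameTy-square p A)

inst-lift : ∀ f y i → f (inst y i) ≡ inst (f y) (lift f i)
inst-lift f y zero = refl
inst-lift f y (suc i) = refl

-- Shifting and prepattern instantiation as renamings

shiftVar-lift : (∀ i → shiftVar c d i ≡ f i) → ∀ i → shiftVar (suc c) d i ≡ lift f i
shiftVar-lift p zero = refl
shiftVar-lift {c} p (suc i) = trans (sym (if-float suc (i <ᵇ c))) (cong suc (p i))

shiftH-rename : (∀ i → shiftVar c d i ≡ f i) → ∀ H → shiftH c d H ≡ renameH f H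
shiftH-rename p (var i) = cong var (p i)
shiftH-rename p (con c) = refl
shiftH-rename p (rec r) = refl

mutual
  shiftTm-rename : (∀ i → shiftVar c d i ≡ f i) → ∀ M → shiftTm c d M ≡ renameTm f M
  shiftTm-rename p (H · S) = cong₂ _·_ (shiftH-rename p H) (shiftSp-rename p S)
  shiftTm-rename p (lam M) = cong lam (shiftTm-rename (shiftVar-lift p) M)

  shiftSp-rename : (∀ i → shiftVar c d i ≡ f i) → ∀ S → shiftSp c d S ≡ renameSp f S
  shiftSp-rename p ε = refl
  shiftSp-rename p (M ∷ S) = cong₂ _∷_ (shiftTm-rename p M) (shiftSp-rename p S)
  shiftSp-rename p ([ y ]∷ S) = cong₂ [_]∷_ (p y) (shiftSp-rename p S)

shiftTy-rename : (∀ i → shiftVar c d i ≡ f i) → ∀ A → shiftTy c d A ≡ renameTy f A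
shiftTy-rename p (atom a S) = cong (atom a) (shiftSp-rename p S)
shiftTy-rename p (Πt A₂ A₁) = cong₂ Πt (shiftTy-rename p A₂) (shiftTy-rename (shiftVar-lift p) A₁)
shiftTy-rename p (Πp A₂ A₁) = cong₂ Πp (shiftTy-rename p A₂) (shiftTy-rename (shiftVar-lift p) A₁)

shiftEntry-suc : ∀ e → shiftEntry 0 1 e ≡ renameEntry suc e
shiftEntry-suc (ord A) = cong ord (shiftTy-rename (λ i → +-comm i 1) A)
shiftEntry-suc (pre A) = cong pre (shiftTy-rename (λ i → +-comm i 1) A)

shiftTm-zero : ∀ M → shiftTm 0 0 M ≡ M
shiftTm-zero M = trans (shiftTm-rename +-identityʳ M) (renameTm-id (λ _ → refl) M)

renameTm-shift : ∀ k N → renameTm suc (shiftTm 0 k N) ≡ shiftTm 0 (suc k) N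
renameTm-shift k N = trans (cong (renameTm suc) (shiftTm-rename (λ _ → refl) N))
  (trans (renameTm-∘ (λ _ → refl) N) (sym (shiftTm-rename (λ i → +-suc i k) N)))

renVar-suc : ∀ y k i → renVar y (suc k) (suc i) ≡ suc (renVar y k i)
renVar-suc y zero zero = +-suc y 0
renVar-suc y (suc k) zero = refl
renVar-suc y k (suc i) with suc i <ᵇ k
... | true = refl
... | false with suc i ≡ᵇ k
...   | true = +-suc y k
...   | false = refl

renVar-lift : (∀ i → renVar y k i ≡ f i) → ∀ i → renVar y (suc k) i ≡ lift f i
renVar-lift p zero = refl
renVar-lift {y} {k} p (suc i) = trans (renVar-suc y k i) (cong suc (p i))

renH-rename : (∀ i → renVar y k i ≡ f i) → ∀ H → renH y k H ≡ renameH f H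
renH-rename p (var i) = cong var (p i)
renH-rename p (con c) = refl
renH-rename p (rec r) = refl

mutual
  renTm-rename : (∀ i → renVar y k i ≡ f i) → ∀ M → renTm y k M ≡ renameTm f M
  renTm-rename p (H · S) = cong₂ _·_ (renH-rename p H) (renSp-rename p S)
  renTm-rename p (lam M) = cong lam (renTm-rename (renVar-lift p) M)

  renSp-rename : (∀ i → renVar y k i ≡ f i) → ∀ S → renSp y k S ≡ renameSp f S
  renSp-rename p ε = refl
  renSp-rename p (M ∷ S) = cong₂ _∷_ (renTm-rename p M) (renSp-rename p S)
  renSp-rename p ([ y ]∷ S) = cong₂ [_]∷_ (p y) (renSp-rename p S)

renTy-rename : (∀ i → renVar y k i ≡ f i) → ∀ A → renTy y k A ≡ renameTy f A
renTy-rename p (atom a S) = cong (atom a) (renSp-rename p S)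
renTy-rename p (Πt A₂ A₁) = cong₂ Πt (renTy-rename p A₂) (renTy-rename (renVar-lift p) A₁)
renTy-rename p (Πp A₂ A₁) = cong₂ Πp (renTy-rename p A₂) (renTy-rename (renVar-lift p) A₁)

renVar-inst : ∀ y i → renVar y 0 i ≡ inst y i
renVar-inst y zero = +-identityʳ y
renVar-inst y (suc i) = refl

renTm-inst : ∀ y M → renTm y 0 M ≡ renameTm (inst y) M
renTm-inst y = renTm-rename (renVar-inst y)

renTy-inst : ∀ y A → renTy y 0 A ≡ renameTy (inst y) A
renTy-inst y = renTy-rename (renVar-inst y)

-- Hereditary substitution as a relation

-- Ins k i j : removing index k from the context turns index j into i.
data Ins : ℕ → ℕ → ℕ → Set where
  zero : Ins 0 i (suc i)
  suc₀ : Ins (suc k) 0 0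
  suc  : Ins k i j → Ins (suc k) (suc i) (suc j)

Ins-irrefl : ¬ Ins k i k
Ins-irrefl (suc p) = Ins-irrefl p

Ins-injective : Ins k i j → Ins k i' j → i ≡ i'
Ins-injective zero zero = refl
Ins-injective suc₀ suc₀ = refl
Ins-injective (suc p) (suc q) = cong suc (Ins-injective p q)

Ins-functional : Ins k i j → Ins k i j' → j ≡ j'
Ins-functional zero zero = refl
Ins-functional suc₀ suc₀ = refl
Ins-functional (suc p) (suc q) = cong suc (Ins-functional p q)

Ins-exchange : Ins l j' j → Ins j l' l → Ins j i k → Ins l i' k →
  ∃[ m ] (Ins l' m i × Ins j' m i')
Ins-exchange suc₀ zero zero (suc q) = _ , q , zero
Ins-exchange zero suc₀ (suc p) zero = _ , zero , p
Ins-exchange (suc u) (suc v) suc₀ suc₀ = _ , suc₀ , suc₀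
Ins-exchange (suc u) (suc v) (suc p) (suc q) with Ins-exchange u v p q
... | _ , p' , q' = _ , suc p' , suc q'

punch : ℕ → ℕ → ℕ
punch zero i = suc i
punch (suc k) = lift (punch k)

Ins-punch : ∀ k i → Ins k i (punch k i)
Ins-punch zero i = zero
Ins-punch (suc k) zero = suc₀
Ins-punch (suc k) (suc i) = suc (Ins-punch k i)

Ins-lift : (∀ i → Ins k i (f i)) → ∀ i → Ins (suc k) i (lift f i)
Ins-lift p zero = suc₀
Ins-lift p (suc i) = suc (p i)

-- SubTm τ N k M M' is the graph of hereditary substitution, except that N
-- lives in the context of the result, so that it is weakened under binders.
mutual
  data SubTm (τ : STy) : Tm → ℕ → Tm → Tm → Set where
    lam  : SubTm τ (renameTm suc N) (suc k) M M' → SubTm τ N k (lam M) (lam M')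
    var≠ : Ins k i j → SubSp τ N k S S' → SubTm τ N k (var j · S) (var i · S')
    var= : SubSp τ N k S S' → Red τ S' N R → SubTm τ N k (var k · S) R
    con  : SubSp τ N k S S' → SubTm τ N k (con c · S) (con c · S')
    rec  : SubSp τ N k S S' → SubTm τ N k (rec r · S) (rec r · S')

  data SubSp (τ : STy) : Tm → ℕ → Sp → Sp → Set where
    ε     : SubSp τ N k ε ε
    _∷_   : SubTm τ N k M M' → SubSp τ N k S S' → SubSp τ N k (M ∷ S) (M' ∷ S')
    [_]∷_ : Ins k i j → SubSp τ N k S S' → SubSp τ N k ([ j ]∷ S) ([ i ]∷ S')

  data Red : STy → Sp → Tm → Tm → Set where
    ε     : Red * ε R R
    _∷_   : SubTm σ M 0 B B' → Red τ S B' R → Red (σ ⇒ τ) (M ∷ S) (lam B) R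
    [_]∷_ : ∀ y → Red τ S (renameTm (inst y) B) R → Red (* ⇒ τ) ([ y ]∷ S) (lam B) R

data SubTy (τ : STy) : Tm → ℕ → Ty → Ty → Set where
  atom : SubSp τ N k S S' → SubTy τ N k (atom a S) (atom a S')
  Πt   : SubTy τ N k A₂ A → SubTy τ (renameTm suc N) (suc k) A₁ A' → SubTy τ N k (Πt A₂ A₁) (Πt A A')
  Πp   : SubTy τ N k A₂ A → SubTy τ (renameTm suc N) (suc k) A₁ A' → SubTy τ N k (Πp A₂ A₁) (Πp A A')

data SubEntry (τ : STy) : Tm → ℕ → Entry → Entry → Set where
  ord : SubTy τ N k A A' → SubEntry τ N k (ord A) (ord A')
  pre : SubTy τ N k A A' → SubEntry τ N k (pre A) (pre A')

-- The three-way comparison made by substTm and substSp.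
select : {X : Set} → ℕ → ℕ → X → X → X → X
select k i lt eq gt = if i <ᵇ k then lt else if i ≡ᵇ k then eq else gt

select-eq : ∀ {X : Set} k {lt eq gt : X} → select k k lt eq gt ≡ eq
select-eq zero = refl
select-eq (suc k) = select-eq k

select-Ins : ∀ {X : Set} {eq : X} (φ : ℕ → X) → Ins k i j → select k j (φ j) eq (φ (j ∸ 1)) ≡ φ i
select-Ins φ zero = refl
select-Ins φ suc₀ = refl
-- The induction hypothesis for `φ` after `suc` speaks of `suc (j ∸ 1)` where the goal has `j`.
-- These agree only for positive `j`, so zero is split off.
select-Ins φ (suc {k} {j = zero} p) with p
... | suc₀ = refl
select-Ins φ (suc {k} {j = suc j} p) = select-Ins (λ i → φ (suc i)) p

data Position (k : ℕ) : ℕ → Set where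
  at   : Position k k
  away : Ins k i j → Position k j

position : ∀ k i → Position k i
position zero zero = at
position zero (suc i) = away zero
position (suc k) zero = away suc₀
position (suc k) (suc i) with position k i
... | at = at
... | away p = away (suc p)

substTm-var≠ : Ins k i j → substTm τ N k (var j · S) ≡ map (var i ·_) (substSp τ N k S)
substTm-var≠ {k} {τ = τ} {N} {S} = select-Ins (λ i → map (var i ·_) (substSp τ N k S))

substSp-pre≠ : Ins k i j → substSp τ N k ([ j ]∷ S) ≡ map ([ i ]∷_) (substSp τ N k S)
substSp-pre≠ {k} {τ = τ} {N} {S} = select-Ins (λ i → map ([ i ]∷_) (substSp τ N k S))

just-map : ∀ {X Y : Set} (φ : X → Y) m {y} → map φ m ≡ just y → ∃[ x ] (m ≡ just x × φ x ≡ y)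
just-map φ (just x) refl = x , refl , refl

just->>= : ∀ {X Y : Set} {φ : X → Maybe Y} {m y} → (m >>= φ) ≡ just y → ∃[ x ] (m ≡ just x × φ x ≡ just y)
just->>= {m = just x} p = x , refl , p

just-map₂ : ∀ {X Y Z : Set} (φ : X → Y → Z) m n {z} → (just φ <*> m <*> n) ≡ just z →
  ∃[ x ] ∃[ y ] (m ≡ just x × n ≡ just y × φ x y ≡ z)
just-map₂ φ (just x) (just y) refl = x , y , refl , refl , refl

mutual
  substTm-sound : ∀ τ N k M → substTm τ N k M ≡ just M' → SubTm τ (shiftTm 0 k N) k M M'
  substTm-sound τ N k (lam M) p with just-map lam (substTm τ N (suc k) M) p
  ... | _ , q , refl = lam (subst (λ L → SubTm τ L (suc k) M _) (sym (renameTm-shift k N)) (substTm-sound τ N (suc k) M q))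
  substTm-sound τ N k (var j · S) p with position k j
  ... | at with just->>= (trans (sym (select-eq k)) p)
  ...   | _ , q , q' = var= (substSp-sound τ N k S q) (reduce-sound τ _ _ q')
  substTm-sound τ N k (var j · S) p | away {i} u with just-map (var i ·_) (substSp τ N k S) (trans (sym (substTm-var≠ {τ = τ} {N} {S} u)) p)
  ...   | _ , q , refl = var≠ u (substSp-sound τ N k S q)
  substTm-sound τ N k (con c · S) p with just-map (con c ·_) (substSp τ N k S) p
  ... | _ , q , refl = con (substSp-sound τ N k S q)
  substTm-sound τ N k (rec r · S) p with just-map (rec r ·_) (substSp τ N k S) p
  ... | _ , q , refl = rec (substSp-sound τ N k S q)

  substSp-sound : ∀ τ N k S → substSp τ N k S ≡ just S' → SubSp τ (shiftTm 0 k N) k S S'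
  substSp-sound τ N k ε refl = ε
  substSp-sound τ N k (M ∷ S) p with just-map₂ _∷_ (substTm τ N k M) (substSp τ N k S) p
  ... | _ , _ , q , q' , refl = substTm-sound τ N k M q ∷ substSp-sound τ N k S q'
  substSp-sound τ N k ([ z ]∷ S) p with position k z
  ... | at with trans (sym (select-eq k)) p
  ...   | ()
  substSp-sound τ N k ([ z ]∷ S) p | away {i} u with just-map ([ i ]∷_) (substSp τ N k S) (trans (sym (substSp-pre≠ {τ = τ} {N} {S} u)) p)
  ...   | _ , q , refl = [ u ]∷ substSp-sound τ N k S q

  reduce-sound : ∀ τ S R → reduce τ S R ≡ just R' → Red τ S R R'
  reduce-sound * ε R refl = ε
  reduce-sound (σ ⇒ τ) (M ∷ S) (lam B) p with just->>= {m = substTm σ M 0 B} p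
  ... | B' , q , q' = subst (λ L → SubTm σ L 0 B B') (shiftTm-zero M) (substTm-sound σ M 0 B q) ∷ reduce-sound τ S B' q'
  reduce-sound (* ⇒ τ) ([ y ]∷ S) (lam B) p =
    [ y ]∷ subst (λ L → Red τ S L _) (renTm-inst y B) (reduce-sound τ S _ p)

mutual
  -- The substituend of the graph is tied to the shifted `N` by an equation, so that derivations can
  -- be matched: under a binder it is a renaming by `suc`, which equals the next shift only
  -- propositionally.
  substTm-complete : ∀ N → N' ≡ shiftTm 0 k N → SubTm τ N' k M M' → substTm τ N k M ≡ just M'
  substTm-complete {k = k} N refl (lam d) rewrite substTm-complete N (renameTm-shift k N) d = refl
  substTm-complete {τ = τ} N e (var≠ {S = S} u d) rewrite substTm-var≠ {τ = τ} {N} {S} u | substSp-complete N e d = refl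
  substTm-complete {k = k} {τ = τ} N refl (var= {S = S} d r) =
    trans (select-eq k) (trans (cong (_>>= λ S' → reduce τ S' (shiftTm 0 k N)) (substSp-complete N refl d)) (reduce-complete r))
  substTm-complete N e (con d) rewrite substSp-complete N e d = refl
  substTm-complete N e (rec d) rewrite substSp-complete N e d = refl

  substSp-complete : ∀ N → N' ≡ shiftTm 0 k N → SubSp τ N' k S S' → substSp τ N k S ≡ just S'
  substSp-complete N e ε = refl
  substSp-complete N e (d ∷ ds) rewrite substTm-complete N e d | substSp-complete N e ds = refl
  substSp-complete {τ = τ} N e ([_]∷_ {S = S} u ds) rewrite substSp-pre≠ {τ = τ} {N} {S} u | substSp-complete N e ds = refl

  reduce-complete : Red τ S R R' → reduce τ S R ≡ just R'
  reduce-complete ε = refl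
  reduce-complete (_∷_ {M = M} d r) rewrite substTm-complete M (sym (shiftTm-zero M)) d = reduce-complete r
  reduce-complete ([_]∷_ {τ = *} {B = B} y r) rewrite renTm-inst y B = reduce-complete r
  reduce-complete ([_]∷_ {τ = _ ⇒ _} {B = B} y r) rewrite renTm-inst y B = reduce-complete r

substTy-sound : ∀ τ N k A → substTy τ N k A ≡ just A' → SubTy τ (shiftTm 0 k N) k A A'
substTy-sound τ N k (atom a S) p with just-map (atom a) (substSp τ N k S) p
... | _ , q , refl = atom (substSp-sound τ N k S q)
substTy-sound τ N k (Πt A₂ A₁) p with just-map₂ Πt (substTy τ N k A₂) (substTy τ N (suc k) A₁) p
... | _ , _ , q , q' , refl = Πt (substTy-sound τ N k A₂ q)
  (subst (λ L → SubTy τ L (suc k) A₁ _) (sym (renameTm-shift k N)) (substTy-sound τ N (suc k) A₁ q'))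
substTy-sound τ N k (Πp A₂ A₁) p with just-map₂ Πp (substTy τ N k A₂) (substTy τ N (suc k) A₁) p
... | _ , _ , q , q' , refl = Πp (substTy-sound τ N k A₂ q)
  (subst (λ L → SubTy τ L (suc k) A₁ _) (sym (renameTm-shift k N)) (substTy-sound τ N (suc k) A₁ q'))

substTy-complete : ∀ N → N' ≡ shiftTm 0 k N → SubTy τ N' k A A' → substTy τ N k A ≡ just A'
substTy-complete N e (atom d) rewrite substSp-complete N e d = refl
substTy-complete {k = k} N refl (Πt d d')
  rewrite substTy-complete N refl d | substTy-complete N (renameTm-shift k N) d' = refl
substTy-complete {k = k} N refl (Πp d d')
  rewrite substTy-complete N refl d | substTy-complete N (renameTm-shift k N) d' = refl

substTy₀-sound : substTy τ N 0 A ≡ just A' → SubTy τ N 0 A A'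
substTy₀-sound {τ} {N} {A} p = subst (λ L → SubTy τ L 0 A _) (shiftTm-zero N) (substTy-sound τ N 0 A p)

substTy₀-complete : SubTy τ N 0 A A' → substTy τ N 0 A ≡ just A'
substTy₀-complete {N = N} = substTy-complete N (sym (shiftTm-zero N))

-- Hereditary substitution and renaming

Ins-rename : (∀ {i j} → Ins k i j → Ins k' (g i) (f j)) →
  ∀ {i j} → Ins (suc k) i j → Ins (suc k') (lift g i) (lift f j)
Ins-rename q suc₀ = suc₀
Ins-rename q (suc p) = suc (q p)

mutual
  -- Here `f` acts on the context that still has the variable and `g` on the one without it; the
  -- third hypothesis says that they agree once it is removed. This form covers weakening, passage
  -- under a binder and instantiation of a bound prepattern variable.
  SubTm-rename : ∀ k' → f k ≡ k' → (∀ {i j} → Ins k i j → Ins k' (g i) (f j)) →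
    SubTm τ N k M M' → SubTm τ (renameTm g N) k' (renameTm f M) (renameTm g M')
  SubTm-rename {N = N} k' p q (lam d) =
    lam (subst (λ L → SubTm _ L _ _ _) (renameTm-square (λ _ → refl) N)
      (SubTm-rename (suc k') (cong suc p) (Ins-rename q) d))
  SubTm-rename k' p q (var≠ u d) = var≠ (q u) (SubSp-rename k' p q d)
  SubTm-rename k' refl q (var= d r) = var= (SubSp-rename k' refl q d) (Red-rename r)
  SubTm-rename k' p q (con d) = con (SubSp-rename k' p q d)
  SubTm-rename k' p q (rec d) = rec (SubSp-rename k' p q d)

  SubSp-rename : ∀ k' → f k ≡ k' → (∀ {i j} → Ins k i j → Ins k' (g i) (f j)) →
    SubSp τ N k S S' → SubSp τ (renameTm g N) k' (renameSp f S) (renameSp g S')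
  SubSp-rename k' p q ε = ε
  SubSp-rename k' p q (d ∷ ds) = SubTm-rename k' p q d ∷ SubSp-rename k' p q ds
  SubSp-rename k' p q ([ u ]∷ ds) = [ q u ]∷ SubSp-rename k' p q ds

  Red-rename : Red τ S R R' → Red τ (renameSp g S) (renameTm g R) (renameTm g R')
  Red-rename ε = ε
  Red-rename (d ∷ r) = SubTm-rename 0 refl (λ { zero → zero }) d ∷ Red-rename r
  Red-rename {g = g} ([_]∷_ {B = B} y r) =
    [ g y ]∷ subst (λ L → Red _ _ L _) (renameTm-square (inst-lift g y) B) (Red-rename r)

SubTy-rename : ∀ k' → f k ≡ k' → (∀ {i j} → Ins k i j → Ins k' (g i) (f j)) →
  SubTy τ N k A A' → SubTy τ (renameTm g N) k' (renameTy f A) (renameTy g A')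
SubTy-rename k' p q (atom d) = atom (SubSp-rename k' p q d)
SubTy-rename {N = N} k' p q (Πt d d') = Πt (SubTy-rename k' p q d)
  (subst (λ L → SubTy _ L _ _ _) (renameTm-square (λ _ → refl) N)
    (SubTy-rename (suc k') (cong suc p) (Ins-rename q) d'))
SubTy-rename {N = N} k' p q (Πp d d') = Πp (SubTy-rename k' p q d)
  (subst (λ L → SubTy _ L _ _ _) (renameTm-square (λ _ → refl) N)
    (SubTy-rename (suc k') (cong suc p) (Ins-rename q) d'))

SubTm-suc : SubTm τ N k M M' → SubTm τ (renameTm suc N) (suc k) (renameTm suc M) (renameTm suc M')
SubTm-suc = SubTm-rename _ refl suc

SubTy-suc : SubTy τ N k A A' → SubTy τ (renameTm suc N) (suc k) (renameTy suc A) (renameTy suc A')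
SubTy-suc = SubTy-rename _ refl suc

Ins-inst : Ins k i j → ∀ {i' j'} → Ins (suc k) i' j' → Ins k (inst i i') (inst j j')
Ins-inst p suc₀ = p
Ins-inst p (suc q) = q

SubTm-inst : Ins k i j → SubTm τ (renameTm suc N) (suc k) M M' →
  SubTm τ N k (renameTm (inst j) M) (renameTm (inst i) M')
SubTm-inst {N = N} p d = subst (λ L → SubTm _ L _ _ _)
  (trans (renameTm-∘ (λ _ → refl) N) (renameTm-id (λ _ → refl) N)) (SubTm-rename _ refl (Ins-inst p) d)

SubTy-inst : Ins k i j → SubTy τ (renameTm suc N) (suc k) A A' →
  SubTy τ N k (renameTy (inst j) A) (renameTy (inst i) A')
SubTy-inst {N = N} p d = subst (λ L → SubTy _ L _ _ _)
  (trans (renameTm-∘ (λ _ → refl) N) (renameTm-id (λ _ → refl) N)) (SubTy-rename _ refl (Ins-inst p) d)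

mutual
  SubTm-cancel : (∀ i → Ins k i (f i)) → ∀ M → SubTm τ N k (renameTm f M) M
  SubTm-cancel p (var i · S) = var≠ (p i) (SubSp-cancel p S)
  SubTm-cancel p (con c · S) = con (SubSp-cancel p S)
  SubTm-cancel p (rec r · S) = rec (SubSp-cancel p S)
  SubTm-cancel p (lam M) = lam (SubTm-cancel (Ins-lift p) M)

  SubSp-cancel : (∀ i → Ins k i (f i)) → ∀ S → SubSp τ N k (renameSp f S) S
  SubSp-cancel p ε = ε
  SubSp-cancel p (M ∷ S) = SubTm-cancel p M ∷ SubSp-cancel p S
  SubSp-cancel p ([ y ]∷ S) = [ p y ]∷ SubSp-cancel p S

SubTy-cancel : (∀ i → Ins k i (f i)) → ∀ A → SubTy τ N k (renameTy f A) A
SubTy-cancel p (atom a S) = atom (SubSp-cancel p S)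
SubTy-cancel p (Πt A₂ A₁) = Πt (SubTy-cancel p A₂) (SubTy-cancel (Ins-lift p) A₁)
SubTy-cancel p (Πp A₂ A₁) = Πp (SubTy-cancel p A₂) (SubTy-cancel (Ins-lift p) A₁)

SubEntry-suc : SubEntry τ N k e e' → SubEntry τ (renameTm suc N) (suc k) (renameEntry suc e) (renameEntry suc e')
SubEntry-suc (ord d) = ord (SubTy-suc d)
SubEntry-suc (pre d) = pre (SubTy-suc d)

SubEntry-cancel : (∀ i → Ins k i (f i)) → ∀ e → SubEntry τ N k (renameEntry f e) e
SubEntry-cancel p (ord A) = ord (SubTy-cancel p A)
SubEntry-cancel p (pre A) = pre (SubTy-cancel p A)

-- The two substitutions are treated symmetrically, each being allowed to act
-- on the substituend of the other. This exchanges the roles of σ and τ at a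
-- head replaced by the second one.
mutual
  SubTm-exchange : ∀ σ τ {M₀ N₀ B₁ B₂} → Ins l j' j → Ins j l' l →
    SubTm τ N₀ l' M M₀ → SubTm σ M₀ j' N N₀ → SubTm σ M j B B₁ → SubTm τ N l B B₂ →
    ∃[ C ] (SubTm τ N₀ l' B₁ C × SubTm σ M₀ j' B₂ C)
  SubTm-exchange σ τ u v m n (lam d) (lam e)
    with SubTm-exchange σ τ (suc u) (suc v) (SubTm-suc m) (SubTm-suc n) d e
  ... | _ , d' , e' = _ , lam d' , lam e'
  SubTm-exchange σ τ u v m n (var≠ p d) (var≠ q e)
    with SubSp-exchange σ τ u v m n d e | Ins-exchange u v p q
  ... | _ , d' , e' | _ , p' , q' = _ , var≠ p' d' , var≠ q' e'
  SubTm-exchange σ τ u v m n (var= d r) (var≠ q e)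
    with Ins-injective u q | SubSp-exchange σ τ u v m n d e
  ... | refl | _ , d' , e' with Red-exchange σ τ r d' m
  ...   | _ , r' , m' = _ , m' , var= e' r'
  SubTm-exchange σ τ u v m n (var≠ p d) (var= e r)
    with Ins-injective v p | SubSp-exchange σ τ u v m n d e
  ... | refl | _ , d' , e' with Red-exchange τ σ r e' n
  ...   | _ , r' , n' = _ , var= d' r' , n'
  SubTm-exchange σ τ u v m n (var= d r) (var= e r') = ⊥-elim (Ins-irrefl u)
  SubTm-exchange σ τ u v m n (con d) (con e) with SubSp-exchange σ τ u v m n d e
  ... | _ , d' , e' = _ , con d' , con e'
  SubTm-exchange σ τ u v m n (rec d) (rec e) with SubSp-exchange σ τ u v m n d e
  ... | _ , d' , e' = _ , rec d' , rec e'

  SubSp-exchange : ∀ σ τ {M₀ N₀ S₁ S₂} → Ins l j' j → Ins j l' l →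
    SubTm τ N₀ l' M M₀ → SubTm σ M₀ j' N N₀ → SubSp σ M j S S₁ → SubSp τ N l S S₂ →
    ∃[ T ] (SubSp τ N₀ l' S₁ T × SubSp σ M₀ j' S₂ T)
  SubSp-exchange σ τ u v m n ε ε = _ , ε , ε
  SubSp-exchange σ τ u v m n (d ∷ ds) (e ∷ es)
    with SubTm-exchange σ τ u v m n d e | SubSp-exchange σ τ u v m n ds es
  ... | _ , d' , e' | _ , ds' , es' = _ , d' ∷ ds' , e' ∷ es'
  SubSp-exchange σ τ u v m n ([ p ]∷ ds) ([ q ]∷ es)
    with Ins-exchange u v p q | SubSp-exchange σ τ u v m n ds es
  ... | _ , p' , q' | _ , ds' , es' = _ , [ p' ]∷ ds' , [ q' ]∷ es'

  Red-exchange : ∀ σ τ {R₁ R₂} → Red σ S R R₁ → SubSp τ N k S S' → SubTm τ N k R R₂ →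
    ∃[ C ] (Red σ S' R₂ C × SubTm τ N k R₁ C)
  Red-exchange * τ ε ε d = _ , ε , d
  Red-exchange (σ₂ ⇒ σ₁) τ (b ∷ r) (m ∷ ds) (lam d)
    -- The weakened `N` does not contain the bound variable, so substituting for it there gives back
    -- `N`. The symmetric statement thereby specialises to the usual law for nested substitutions.
    with SubTm-exchange σ₂ τ suc₀ zero m (SubTm-cancel (λ _ → zero) _) b d
  ... | _ , b' , d' with Red-exchange σ₁ τ r ds b'
  ...   | _ , r' , e = _ , d' ∷ r' , e
  Red-exchange (* ⇒ σ₁) τ ([ y ]∷ r) ([ p ]∷ ds) (lam d) with Red-exchange σ₁ τ r ds (SubTm-inst p d)
  ... | _ , r' , e = _ , [ _ ]∷ r' , e

SubTy-exchange : ∀ {M₀ N₀ B₁ B₂} → Ins l j' j → Ins j l' l →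
  SubTm τ N₀ l' M M₀ → SubTm σ M₀ j' N N₀ → SubTy σ M j A B₁ → SubTy τ N l A B₂ →
  ∃[ C ] (SubTy τ N₀ l' B₁ C × SubTy σ M₀ j' B₂ C)
SubTy-exchange u v m n (atom d) (atom e) with SubSp-exchange _ _ u v m n d e
... | _ , d' , e' = _ , atom d' , atom e'
SubTy-exchange u v m n (Πt d₂ d₁) (Πt e₂ e₁)
  with SubTy-exchange u v m n d₂ e₂ | SubTy-exchange (suc u) (suc v) (SubTm-suc m) (SubTm-suc n) d₁ e₁
... | _ , d₂' , e₂' | _ , d₁' , e₁' = _ , Πt d₂' d₁' , Πt e₂' e₁'
SubTy-exchange u v m n (Πp d₂ d₁) (Πp e₂ e₁)
  with SubTy-exchange u v m n d₂ e₂ | SubTy-exchange (suc u) (suc v) (SubTm-suc m) (SubTm-suc n) d₁ e₁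
... | _ , d₂' , e₂' | _ , d₁' , e₁' = _ , Πp d₂' d₁' , Πp e₂' e₁'

SubTy₀-exchange : ∀ {A₀ M₀} → SubTm τ N k M M₀ → SubTy σ M 0 A A₀ → SubTy τ (renameTm suc N) (suc k) A A' →
  ∃[ C ] (SubTy τ N k A₀ C × SubTy σ M₀ 0 A' C)
SubTy₀-exchange m = SubTy-exchange suc₀ zero m (SubTm-cancel (λ _ → zero) _)

-- Simple typing

-- Erasure reads both kinds of Π over an atomic domain as `* ⇒`, yet a bound variable occurring as
-- `[ x ]` cannot be replaced by a term; erasure alone therefore cannot guarantee definedness. The
-- domain of a prepattern Π is kept as well, since a prepattern variable may also head a term.
data Skel : Set where
  ⋆    : Skel
  _→ₒ_ : Skel → Skel → Skel
  _→ₚ_ : Skel → Skel → Skel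

skel : Ty → Skel
skel (atom a S) = ⋆
skel (Πt A₂ A₁) = skel A₂ →ₒ skel A₁
skel (Πp A₂ A₁) = skel A₂ →ₚ skel A₁

eraseˢ : Skel → STy
eraseˢ ⋆ = *
eraseˢ (ρ₂ →ₒ ρ₁) = eraseˢ ρ₂ ⇒ eraseˢ ρ₁
eraseˢ (ρ₂ →ₚ ρ₁) = * ⇒ eraseˢ ρ₁

data SEntry : Set where
  ord : Skel → SEntry
  pre : Skel → SEntry

skelEntry : Entry → SEntry
skelEntry (ord A) = ord (skel A)
skelEntry (pre A) = pre (skel A)

SCtx : Set
SCtx = List SEntry

skelCtx : Ctx → SCtx
skelCtx [] = []
skelCtx (e ∷ Γ) = skelEntry e ∷ skelCtx Γ

data _∋ˢ_⦂_ : SCtx → ℕ → SEntry → Set where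
  here  : ∀ {η Φ} → (η ∷ Φ) ∋ˢ 0 ⦂ η
  there : ∀ {η η' Φ} → Φ ∋ˢ i ⦂ η → (η' ∷ Φ) ∋ˢ suc i ⦂ η

private variable
  Φ Ψ : SCtx
  η : SEntry
  ρ ρ₁ ρ₂ : Skel

erase-skel : ∀ A → erase A ≡ eraseˢ (skel A)
erase-skel (atom a S) = refl
erase-skel (Πt A₂ A₁) = cong₂ _⇒_ (erase-skel A₂) (erase-skel A₁)
erase-skel (Πp A₂ A₁) = cong (* ⇒_) (erase-skel A₁)

skel-erase : ∀ {A B} → skel A ≡ skel B → erase A ≡ erase B
skel-erase {A} {B} p = trans (erase-skel A) (trans (cong eraseˢ p) (sym (erase-skel B)))

skel-rename : ∀ f A → skel (renameTy f A) ≡ skel A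
skel-rename f (atom a S) = refl
skel-rename f (Πt A₂ A₁) = cong₂ _→ₒ_ (skel-rename f A₂) (skel-rename (lift f) A₁)
skel-rename f (Πp A₂ A₁) = cong₂ _→ₚ_ (skel-rename f A₂) (skel-rename (lift f) A₁)

skelEntry-rename : ∀ f e → skelEntry (renameEntry f e) ≡ skelEntry e
skelEntry-rename f (ord A) = cong ord (skel-rename f A)
skelEntry-rename f (pre A) = cong pre (skel-rename f A)

skel-SubTy : SubTy τ N k A A' → skel A ≡ skel A'
skel-SubTy (atom d) = refl
skel-SubTy (Πt d d') = cong₂ _→ₒ_ (skel-SubTy d) (skel-SubTy d')
skel-SubTy (Πp d d') = cong₂ _→ₚ_ (skel-SubTy d) (skel-SubTy d')

skel-TyEq : TyEq Sg A A' → skel A ≡ skel A'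
skel-TyEq (atom _) = refl
skel-TyEq (Πt p q) = cong₂ _→ₒ_ (skel-TyEq p) (skel-TyEq q)
skel-TyEq (Πp p q) = cong₂ _→ₚ_ (skel-TyEq p) (skel-TyEq q)

data SHead (Sg : Sig) (Φ : SCtx) : Head → Skel → Set where
  var  : Φ ∋ˢ i ⦂ ord ρ → SHead Sg Φ (var i) ρ
  pvar : Φ ∋ˢ i ⦂ pre ρ → SHead Sg Φ (var i) ρ
  con  : cst c A ∈ Sg → SHead Sg Φ (con c) (skel A)
  rec  : rdef r A M ∈ Sg → SHead Sg Φ (rec r) (skel A)

mutual
  data SCheck (Sg : Sig) (Φ : SCtx) : Tm → Skel → Set where
    lamₒ : SCheck Sg (ord ρ₂ ∷ Φ) M ρ₁ → SCheck Sg Φ (lam M) (ρ₂ →ₒ ρ₁)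
    lamₚ : SCheck Sg (pre ρ₂ ∷ Φ) M ρ₁ → SCheck Sg Φ (lam M) (ρ₂ →ₚ ρ₁)
    _·_  : SHead Sg Φ H ρ → SSp Sg Φ S ρ → SCheck Sg Φ (H · S) ⋆

  data SSp (Sg : Sig) (Φ : SCtx) : Sp → Skel → Set where
    ε     : SSp Sg Φ ε ⋆
    _∷_   : SCheck Sg Φ M ρ₂ → SSp Sg Φ S ρ₁ → SSp Sg Φ (M ∷ S) (ρ₂ →ₒ ρ₁)
    [_]∷_ : Φ ∋ˢ y ⦂ pre ρ₂ → SSp Sg Φ S ρ₁ → SSp Sg Φ ([ y ]∷ S) (ρ₂ →ₚ ρ₁)

-- The skeleton of the spine is arbitrary: the kind of the family is forgotten, and what remains
-- suffices for substitution to be defined and equality to be reflexive.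
data SWf (Sg : Sig) (Φ : SCtx) : Ty → Set where
  atom : SSp Sg Φ S ρ → SWf Sg Φ (atom a S)
  Πt   : SWf Sg Φ A₂ → SWf Sg (ord (skel A₂) ∷ Φ) A₁ → SWf Sg Φ (Πt A₂ A₁)
  Πp   : SWf Sg Φ A₂ → SWf Sg (pre (skel A₂) ∷ Φ) A₁ → SWf Sg Φ (Πp A₂ A₁)

-- Renaming, closedness and totality of substitution for simple typing

SRen : (ℕ → ℕ) → SCtx → SCtx → Set
SRen f Φ Ψ = ∀ {i η} → Φ ∋ˢ i ⦂ η → Ψ ∋ˢ f i ⦂ η

SRen-lift : SRen f Φ Ψ → SRen (lift f) (η ∷ Φ) (η ∷ Ψ)
SRen-lift p here = here
SRen-lift p (there x) = there (p x)

SRen-inst : Φ ∋ˢ y ⦂ η → SRen (inst y) (η ∷ Φ) Φ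
SRen-inst x here = x
SRen-inst x (there z) = z

SRen-empty : SRen f [] Ψ
SRen-empty ()

SHead-rename : SRen f Φ Ψ → SHead Sg Φ H ρ → SHead Sg Ψ (renameH f H) ρ
SHead-rename p (var x) = var (p x)
SHead-rename p (pvar x) = pvar (p x)
SHead-rename p (con m) = con m
SHead-rename p (rec m) = rec m

mutual
  SCheck-rename : SRen f Φ Ψ → SCheck Sg Φ M ρ → SCheck Sg Ψ (renameTm f M) ρ
  SCheck-rename p (lamₒ d) = lamₒ (SCheck-rename (SRen-lift p) d)
  SCheck-rename p (lamₚ d) = lamₚ (SCheck-rename (SRen-lift p) d)
  SCheck-rename p (h · s) = SHead-rename p h · SSp-rename p s

  SSp-rename : SRen f Φ Ψ → SSp Sg Φ S ρ → SSp Sg Ψ (renameSp f S) ρ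
  SSp-rename p ε = ε
  SSp-rename p (d ∷ s) = SCheck-rename p d ∷ SSp-rename p s
  SSp-rename p ([ x ]∷ s) = [ p x ]∷ SSp-rename p s

SWf-rename : SRen f Φ Ψ → SWf Sg Φ A → SWf Sg Ψ (renameTy f A)
SWf-rename p (atom s) = atom (SSp-rename p s)
SWf-rename {f} p (Πt {A₂ = A₂} w w') = Πt (SWf-rename p w)
  (subst (λ ρ → SWf _ (ord ρ ∷ _) _) (sym (skel-rename f A₂)) (SWf-rename (SRen-lift p) w'))
SWf-rename {f} p (Πp {A₂ = A₂} w w') = Πp (SWf-rename p w)
  (subst (λ ρ → SWf _ (pre ρ ∷ _) _) (sym (skel-rename f A₂)) (SWf-rename (SRen-lift p) w'))

Fixes : (ℕ → ℕ) → SCtx → Set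
Fixes f Φ = ∀ {i η} → Φ ∋ˢ i ⦂ η → f i ≡ i

Fixes-lift : Fixes f Φ → Fixes (lift f) (η ∷ Φ)
Fixes-lift p here = refl
Fixes-lift p (there x) = cong suc (p x)

Fixes-empty : Fixes f []
Fixes-empty ()

SHead-fixed : Fixes f Φ → SHead Sg Φ H ρ → renameH f H ≡ H
SHead-fixed p (var x) = cong var (p x)
SHead-fixed p (pvar x) = cong var (p x)
SHead-fixed p (con m) = refl
SHead-fixed p (rec m) = refl

mutual
  SCheck-fixed : Fixes f Φ → SCheck Sg Φ M ρ → renameTm f M ≡ M
  SCheck-fixed p (lamₒ d) = cong lam (SCheck-fixed (Fixes-lift p) d)
  SCheck-fixed p (lamₚ d) = cong lam (SCheck-fixed (Fixes-lift p) d)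
  SCheck-fixed p (h · s) = cong₂ _·_ (SHead-fixed p h) (SSp-fixed p s)

  SSp-fixed : Fixes f Φ → SSp Sg Φ S ρ → renameSp f S ≡ S
  SSp-fixed p ε = refl
  SSp-fixed p (d ∷ s) = cong₂ _∷_ (SCheck-fixed p d) (SSp-fixed p s)
  SSp-fixed p ([ x ]∷ s) = cong₂ [_]∷_ (p x) (SSp-fixed p s)

SWf-fixed : Fixes f Φ → SWf Sg Φ A → renameTy f A ≡ A
SWf-fixed p (atom s) = cong (atom _) (SSp-fixed p s)
SWf-fixed p (Πt w w') = cong₂ Πt (SWf-fixed p w) (SWf-fixed (Fixes-lift p) w')
SWf-fixed p (Πp w w') = cong₂ Πp (SWf-fixed p w) (SWf-fixed (Fixes-lift p) w')

-- Stated pointwise, so that no context has to be split when passing a binder. The removed entry is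
-- ordinary, which excludes `[ k ]` from spines, the case in which substitution is undefined.
SSub : ℕ → Skel → SCtx → SCtx → Set
SSub k ρ Φ Ψ = ∀ {i η} → Φ ∋ˢ i ⦂ η → (i ≡ k × η ≡ ord ρ) ⊎ ∃[ i' ] (Ins k i' i × Ψ ∋ˢ i' ⦂ η)

SSub-zero : SSub 0 ρ (ord ρ ∷ Φ) Φ
SSub-zero here = inj₁ (refl , refl)
SSub-zero (there x) = inj₂ (_ , zero , x)

SSub-suc : SSub k ρ Φ Ψ → SSub (suc k) ρ (η ∷ Φ) (η ∷ Ψ)
SSub-suc s here = inj₂ (_ , suc₀ , here)
SSub-suc s (there x) with s x
... | inj₁ (refl , refl) = inj₁ (refl , refl)
... | inj₂ (_ , p , z) = inj₂ (_ , suc p , there z)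

mutual
  -- At fixed `ρ` the derivation shrinks. At a replaced head, `N` meets a spine of unbounded size,
  -- but every substitution started there is at a component of `ρ`.
  SCheck-sub : ∀ ρ → SSub k ρ Φ Ψ → SCheck Sg Ψ N ρ → SCheck Sg Φ M ρ₁ →
    ∃[ M' ] (SubTm (eraseˢ ρ) N k M M' × SCheck Sg Ψ M' ρ₁)
  SCheck-sub ρ s n (lamₒ d) with SCheck-sub ρ (SSub-suc s) (SCheck-rename there n) d
  ... | _ , e , d' = _ , lam e , lamₒ d'
  SCheck-sub ρ s n (lamₚ d) with SCheck-sub ρ (SSub-suc s) (SCheck-rename there n) d
  ... | _ , e , d' = _ , lam e , lamₚ d'
  SCheck-sub ρ s n (var x · t) with s x | SSp-sub ρ s n t
  ... | inj₁ (refl , refl) | _ , e , t' with SCheck-reduce ρ n t'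
  ...   | _ , r , d = _ , var= e r , d
  SCheck-sub ρ s n (var x · t) | inj₂ (_ , p , z) | _ , e , t' = _ , var≠ p e , var z · t'
  SCheck-sub ρ s n (pvar x · t) with s x | SSp-sub ρ s n t
  ... | inj₁ (refl , ()) | _
  ... | inj₂ (_ , p , z) | _ , e , t' = _ , var≠ p e , pvar z · t'
  SCheck-sub ρ s n (con m · t) with SSp-sub ρ s n t
  ... | _ , e , t' = _ , con e , con m · t'
  SCheck-sub ρ s n (rec m · t) with SSp-sub ρ s n t
  ... | _ , e , t' = _ , rec e , rec m · t'

  SSp-sub : ∀ ρ → SSub k ρ Φ Ψ → SCheck Sg Ψ N ρ → SSp Sg Φ S ρ₁ →
    ∃[ S' ] (SubSp (eraseˢ ρ) N k S S' × SSp Sg Ψ S' ρ₁)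
  SSp-sub ρ s n ε = _ , ε , ε
  SSp-sub ρ s n (d ∷ t) with SCheck-sub ρ s n d | SSp-sub ρ s n t
  ... | _ , e , d' | _ , es , t' = _ , e ∷ es , d' ∷ t'
  SSp-sub ρ s n ([ x ]∷ t) with s x | SSp-sub ρ s n t
  ... | inj₁ (refl , ()) | _
  ... | inj₂ (_ , p , z) | _ , es , t' = _ , [ p ]∷ es , [ z ]∷ t'

  SCheck-reduce : ∀ ρ → SCheck Sg Φ R ρ → SSp Sg Φ S ρ →
    ∃[ R' ] (Red (eraseˢ ρ) S R R' × SCheck Sg Φ R' ⋆)
  SCheck-reduce ⋆ d ε = _ , ε , d
  SCheck-reduce (ρ₂ →ₒ ρ₁) (lamₒ d) (n ∷ t) with SCheck-sub ρ₂ SSub-zero n d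
  ... | _ , e , d' with SCheck-reduce ρ₁ d' t
  ...   | _ , r , d'' = _ , e ∷ r , d''
  SCheck-reduce (ρ₂ →ₚ ρ₁) (lamₚ d) ([ x ]∷ t) with SCheck-reduce ρ₁ (SCheck-rename (SRen-inst x) d) t
  ... | _ , r , d' = _ , [ _ ]∷ r , d'

SWf-sub : SSub k ρ Φ Ψ → SCheck Sg Ψ N ρ → SWf Sg Φ A →
  ∃[ A' ] (SubTy (eraseˢ ρ) N k A A' × SWf Sg Ψ A')
SWf-sub s n (atom t) with SSp-sub _ s n t
... | _ , e , t' = _ , atom e , atom t'
SWf-sub s n (Πt w w') with SWf-sub s n w | SWf-sub (SSub-suc s) (SCheck-rename there n) w'
... | _ , e , v | _ , e' , v' = _ , Πt e e' , Πt v (subst (λ ρ → SWf _ (ord ρ ∷ _) _) (skel-SubTy e) v')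
SWf-sub s n (Πp w w') with SWf-sub s n w | SWf-sub (SSub-suc s) (SCheck-rename there n) w'
... | _ , e , v | _ , e' , v' = _ , Πp e e' , Πp v (subst (λ ρ → SWf _ (pre ρ ∷ _) _) (skel-SubTy e) v')

-- The graph is single-valued by completeness: both results are the value of the same function.
SWf-sub₀ : SCheck Sg Φ N ρ → SWf Sg (ord ρ ∷ Φ) A → SubTy (eraseˢ ρ) N 0 A A' → SWf Sg Φ A'
SWf-sub₀ n w d with SWf-sub SSub-zero n w
... | _ , e , v = subst (SWf _ _) (just-injective (trans (sym (substTy₀-complete e)) (substTy₀-complete d))) v

-- Spines of recursion constants consist of variables only

data OnlyPre : Sp → Set where
  ε     : OnlyPre ε
  [_]∷_ : ∀ y → OnlyPre S → OnlyPre ([ y ]∷ S)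

mutual
  -- What the transport of equality takes from simple typing. Being free of contexts and types, it
  -- can be assumed of the two sides of an equation separately.
  data RecPreTm : Tm → Set where
    lam : RecPreTm M → RecPreTm (lam M)
    var : RecPreSp S → RecPreTm (var i · S)
    con : RecPreSp S → RecPreTm (con c · S)
    rec : OnlyPre S → RecPreTm (rec r · S)

  data RecPreSp : Sp → Set where
    ε     : RecPreSp ε
    _∷_   : RecPreTm M → RecPreSp S → RecPreSp (M ∷ S)
    [_]∷_ : ∀ y → RecPreSp S → RecPreSp ([ y ]∷ S)

data RecPreTy : Ty → Set where
  atom : RecPreSp S → RecPreTy (atom a S)
  Πt   : RecPreTy A₂ → RecPreTy A₁ → RecPreTy (Πt A₂ A₁)
  Πp   : RecPreTy A₂ → RecPreTy A₁ → RecPreTy (Πp A₂ A₁)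

OnlyPre⇒RecPreSp : OnlyPre S → RecPreSp S
OnlyPre⇒RecPreSp ε = ε
OnlyPre⇒RecPreSp ([ y ]∷ o) = [ y ]∷ OnlyPre⇒RecPreSp o

OnlyPre-rename : OnlyPre S → OnlyPre (renameSp f S)
OnlyPre-rename ε = ε
OnlyPre-rename ([ y ]∷ o) = [ _ ]∷ OnlyPre-rename o

mutual
  RecPreTm-rename : RecPreTm M → RecPreTm (renameTm f M)
  RecPreTm-rename (lam p) = lam (RecPreTm-rename p)
  RecPreTm-rename (var p) = var (RecPreSp-rename p)
  RecPreTm-rename (con p) = con (RecPreSp-rename p)
  RecPreTm-rename (rec o) = rec (OnlyPre-rename o)

  RecPreSp-rename : RecPreSp S → RecPreSp (renameSp f S)
  RecPreSp-rename ε = ε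
  RecPreSp-rename (p ∷ ps) = RecPreTm-rename p ∷ RecPreSp-rename ps
  RecPreSp-rename ([ y ]∷ ps) = [ _ ]∷ RecPreSp-rename ps

-- Substitution is undefined at `[ x ]` for the replaced variable, so a derivation can exist only if
-- that variable is absent; the substitution is then mere strengthening.
OnlyPre-sub : (∀ i → Ins k i (f i)) → OnlyPre S → SubSp τ N k S S' → S ≡ renameSp f S' × OnlyPre S'
OnlyPre-sub p ε ε = refl , ε
OnlyPre-sub p ([ y ]∷ o) ([ q ]∷ ds) with OnlyPre-sub p o ds
... | refl , o' = cong ([_]∷ _) (Ins-functional q (p _)) , [ _ ]∷ o'

mutual
  RecPreTm-sub : RecPreTm N → RecPreTm M → SubTm τ N k M M' → RecPreTm M'
  RecPreTm-sub n (lam p) (lam d) = lam (RecPreTm-sub (RecPreTm-rename n) p d)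
  RecPreTm-sub n (var p) (var≠ _ d) = var (RecPreSp-sub n p d)
  RecPreTm-sub n (var p) (var= d r) = RecPreTm-reduce (RecPreSp-sub n p d) n r
  RecPreTm-sub n (con p) (con d) = con (RecPreSp-sub n p d)
  RecPreTm-sub n (rec o) (rec d) = rec (proj₂ (OnlyPre-sub (Ins-punch _) o d))

  RecPreSp-sub : RecPreTm N → RecPreSp S → SubSp τ N k S S' → RecPreSp S'
  RecPreSp-sub n ε ε = ε
  RecPreSp-sub n (p ∷ ps) (d ∷ ds) = RecPreTm-sub n p d ∷ RecPreSp-sub n ps ds
  RecPreSp-sub n ([ y ]∷ ps) ([ _ ]∷ ds) = [ _ ]∷ RecPreSp-sub n ps ds

  RecPreTm-reduce : RecPreSp S → RecPreTm R → Red τ S R R' → RecPreTm R'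
  RecPreTm-reduce ε p ε = p
  RecPreTm-reduce (n ∷ ps) (lam p) (d ∷ r) = RecPreTm-reduce ps (RecPreTm-sub n p d) r
  RecPreTm-reduce ([ y ]∷ ps) (lam p) ([ _ ]∷ r) = RecPreTm-reduce ps (RecPreTm-rename p) r

RecPreTm-spine : NotRec H → RecPreTm (H · S) → RecPreSp S
RecPreTm-spine _ (var p) = p
RecPreTm-spine _ (con p) = p

SSp-OnlyPre : AllPre A → SSp Sg Φ S (skel A) → OnlyPre S
SSp-OnlyPre pat ε = ε
SSp-OnlyPre (pΠ p) ([ x ]∷ s) = [ _ ]∷ SSp-OnlyPre p s

-- A spine of variables instantiates binders by renaming and inserts no term, so nothing can appear
-- in the result that is outside the image of `f`.
Red-rename⁻¹ : OnlyPre S → ∀ M → Red τ (renameSp f S) (renameTm f M) R →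
  ∃[ R₀ ] (R ≡ renameTm f R₀ × Red τ S M R₀)
Red-rename⁻¹ ε M ε = M , refl , ε
Red-rename⁻¹ {f = f} ([ y ]∷ o) (lam M) ([ _ ]∷ r)
  with Red-rename⁻¹ {f = f} o (renameTm (inst y) M)
    (subst (λ L → Red _ _ L _) (sym (renameTm-square (inst-lift f y) M)) r)
... | R₀ , p , r₀ = R₀ , p , [ y ]∷ r₀

Contractive-rename : Contractive M → Contractive (renameTm f M)
Contractive-rename (ctlam p) = ctlam (Contractive-rename p)
Contractive-rename (cthd {var i} p) = cthd tt
Contractive-rename (cthd {con c} p) = cthd tt

-- Variable arguments only rename the body, so its head stays a variable or a constructor.
Contractive-reduce : OnlyPre S → Contractive R → Red τ S R R' → Contractive R'
Contractive-reduce ε p ε = p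
Contractive-reduce ([ y ]∷ o) (ctlam p) ([ _ ]∷ r) = Contractive-reduce o (Contractive-rename p) r

-- Equality of unfoldings

record SimpleSig (Sg : Sig) : Set where
  field
    rdef-unique   : ∀ {r A M A' M'} → rdef r A M ∈ Sg → rdef r A' M' ∈ Sg → A ≡ A' × M ≡ M'
    cst-wf        : ∀ {c A} → cst c A ∈ Sg → SWf Sg [] A
    rdef-wf       : ∀ {r A M} → rdef r A M ∈ Sg → SWf Sg [] A
    rdef-pre      : ∀ {r A M} → rdef r A M ∈ Sg → AllPre A
    rdef-contract : ∀ {r A M} → rdef r A M ∈ Sg → Contractive M
    rdef-body     : ∀ {r A M} → rdef r A M ∈ Sg → SCheck Sg [] M (skel A)

TmEq : Sig → Tm → Tm → Set
TmEq Sg M M' = ∀ n → EqTm Sg n M M'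

NotRec-rename : ∀ H → NotRec H → NotRec (renameH f H)
NotRec-rename (var i) p = tt
NotRec-rename (con c) p = tt

NotRec-rename⁻¹ : ∀ H → NotRec (renameH f H) → NotRec H
NotRec-rename⁻¹ (var i) p = tt
NotRec-rename⁻¹ (con c) p = tt

renameH-injective : (∀ i → Ins k i (f i)) → ∀ H H' → renameH f H ≡ renameH f H' → H ≡ H'
renameH-injective {k} p (var i) (var j) e =
  cong var (Ins-injective (p i) (subst (Ins k j) (sym (var-injective e)) (p j)))
  where
  var-injective : ∀ {i j} → Head.var i ≡ var j → i ≡ j
  var-injective refl = refl
renameH-injective p (con c) (con .c) refl = refl
renameH-injective p (rec r) (rec .r) refl = refl

mutual
  EqTm-sym : EqTm Sg n M M' → EqTm Sg n M' M
  EqTm-sym eq0 = eq0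
  EqTm-sym (eqlam e) = eqlam (EqTm-sym e)
  EqTm-sym (eqhd u v e) = eqhd v u (EqSp-sym e)

  EqSp-sym : EqSp Sg n S S' → EqSp Sg n S' S
  EqSp-sym eqnil = eqnil
  EqSp-sym (eqcons e es) = eqcons (EqTm-sym e) (EqSp-sym es)
  EqSp-sym (eqpre es) = eqpre (EqSp-sym es)

TyEq-sym : TyEq Sg A A' → TyEq Sg A' A
TyEq-sym (atom e) = atom (λ n → EqSp-sym (e n))
TyEq-sym (Πt e e') = Πt (TyEq-sym e) (TyEq-sym e')
TyEq-sym (Πp e e') = Πp (TyEq-sym e) (TyEq-sym e')

TmEq-lam : TmEq Sg (lam M) (lam M') → TmEq Sg M M'
TmEq-lam e n with e n
... | eq0 = eq0
... | eqlam e' = e'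

-- A head consumes one unit of depth: spines agree to depth `n` because the terms agree to depth
-- `suc n`. Agreement at a single depth would not be inherited.
TmEq-spine : NotRec H → NotRec H' → TmEq Sg (H · S) (H' · S') → H ≡ H' × SpEq Sg S S'
TmEq-spine {var i} {var j} _ _ e = head (e 1) , λ n → tail (e (suc n))
  where
  head : EqTm Sg 1 (var i · S) (var j · S') → Head.var i ≡ var j
  head (eqhd var var _) = refl
  tail : EqTm Sg (suc n) (var i · S) (var j · S') → EqSp Sg n S S'
  tail (eqhd var var e) = e
TmEq-spine {con c} {con d} _ _ e = head (e 1) , λ n → tail (e (suc n))
  where
  head : EqTm Sg 1 (con c · S) (con d · S') → Head.con c ≡ con d
  head (eqhd con con _) = refl
  tail : EqTm Sg (suc n) (con c · S) (con d · S') → EqSp Sg n S S'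
  tail (eqhd con con e) = e
TmEq-spine {var i} {con d} _ _ e with e 1
... | eqhd var () _
TmEq-spine {con c} {var j} _ _ e with e 1
... | eqhd con () _

SpEq-head : SpEq Sg (M ∷ S) (M' ∷ S') → TmEq Sg M M'
SpEq-head e n with e n
... | eqcons e' _ = e'

SpEq-tail : SpEq Sg (M ∷ S) (M' ∷ S') → SpEq Sg S S'
SpEq-tail e n with e n
... | eqcons _ e' = e'

SpEq-pre : SpEq Sg ([ i ]∷ S) ([ j ]∷ S') → i ≡ j × SpEq Sg S S'
SpEq-pre e = head (e 0) , λ n → tail (e n)
  where
  head : EqSp Sg n ([ i ]∷ S) ([ j ]∷ S') → i ≡ j
  head (eqpre _) = refl
  tail : EqSp Sg n ([ i ]∷ S) ([ j ]∷ S') → EqSp Sg n S S'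
  tail (eqpre e) = e

module Equality {Sg : Sig} (ok : SimpleSig Sg) where
  open SimpleSig ok

  SHead-RecPre : SHead Sg Φ H ρ → SSp Sg Φ S ρ → RecPreSp S → RecPreTm (H · S)
  SHead-RecPre (var x) s p = var p
  SHead-RecPre (pvar x) s p = var p
  SHead-RecPre (con m) s p = con p
  SHead-RecPre (rec m) s p = rec (SSp-OnlyPre (rdef-pre m) s)

  mutual
    SCheck-RecPre : SCheck Sg Φ M ρ → RecPreTm M
    SCheck-RecPre (lamₒ d) = lam (SCheck-RecPre d)
    SCheck-RecPre (lamₚ d) = lam (SCheck-RecPre d)
    SCheck-RecPre (h · s) = SHead-RecPre h s (SSp-RecPre s)

    SSp-RecPre : SSp Sg Φ S ρ → RecPreSp S
    SSp-RecPre ε = ε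
    SSp-RecPre (d ∷ s) = SCheck-RecPre d ∷ SSp-RecPre s
    SSp-RecPre ([ x ]∷ s) = [ _ ]∷ SSp-RecPre s

  SWf-RecPre : SWf Sg Φ A → RecPreTy A
  SWf-RecPre (atom s) = atom (SSp-RecPre s)
  SWf-RecPre (Πt w w') = Πt (SWf-RecPre w) (SWf-RecPre w')
  SWf-RecPre (Πp w w') = Πp (SWf-RecPre w) (SWf-RecPre w')

  rdef-closed : ∀ f → rdef r A M ∈ Sg → renameTm f M ≡ M
  rdef-closed f m = SCheck-fixed (Fixes-empty {f}) (rdef-body m)

  Unfold-rename : Unfold Sg H S H' T → Unfold Sg (renameH f H) (renameSp f S) (renameH f H') (renameSp f T)
  Unfold-rename var = var
  Unfold-rename con = con
  Unfold-rename {f = f} (rec {A = A} {M} {S} {h} m p nr) = rec m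
    (reduce-complete (subst (λ L → Red (erase A) (renameSp f S) L _) (rdef-closed f m) (Red-rename (reduce-sound _ S M p))))
    (NotRec-rename h nr)

  Unfold-functional : Unfold Sg H S H' T → ∀ {H'' T'} → Unfold Sg H S H'' T' → H' ≡ H'' × T ≡ T'
  Unfold-functional var var = refl , refl
  Unfold-functional con con = refl , refl
  Unfold-functional (rec m p _) (rec m' p' _) with rdef-unique m m'
  ... | refl , refl with trans (sym p) p'
  ...   | refl = refl , refl

  -- The body of a recursive definition is closed, hence equal to its own renaming, and the spine
  -- holds only variables, so `Red-rename⁻¹` applies to the whole redex.
  Unfold-rename⁻¹ : ∀ H {h T} → RecPreTm (H · S) → Unfold Sg (renameH f H) (renameSp f S) h T →
    ∃[ h₀ ] ∃[ T₀ ] (h ≡ renameH f h₀ × T ≡ renameSp f T₀ × Unfold Sg H S h₀ T₀)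
  Unfold-rename⁻¹ (var i) _ var = _ , _ , refl , refl , var
  Unfold-rename⁻¹ (con c) _ con = _ , _ , refl , refl , con
  Unfold-rename⁻¹ {S} {f} (rec r) (rec o) (rec {A = A} {M} m p nr)
    with Red-rename⁻¹ o M (subst (λ L → Red (erase A) (renameSp f S) L _) (sym (rdef-closed f m)) (reduce-sound _ _ M p))
  ... | h₀ · T₀ , refl , r₀ = h₀ , T₀ , refl , refl , rec m (reduce-complete r₀) (NotRec-rename⁻¹ h₀ nr)

  Unfold-RecPre : RecPreTm (H · S) → Unfold Sg H S H' T → RecPreSp T
  Unfold-RecPre (var p) var = p
  Unfold-RecPre (con p) con = p
  Unfold-RecPre (rec o) (rec {A = A} {S = S} m p nr) = RecPreTm-spine nr
    (RecPreTm-reduce (OnlyPre⇒RecPreSp o) (SCheck-RecPre (rdef-body m)) (reduce-sound (erase A) S _ p))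

  mutual
    EqTm-rename : EqTm Sg n M M' → EqTm Sg n (renameTm f M) (renameTm f M')
    EqTm-rename eq0 = eq0
    EqTm-rename (eqlam e) = eqlam (EqTm-rename e)
    EqTm-rename (eqhd u v e) = eqhd (Unfold-rename u) (Unfold-rename v) (EqSp-rename e)

    EqSp-rename : EqSp Sg n S S' → EqSp Sg n (renameSp f S) (renameSp f S')
    EqSp-rename eqnil = eqnil
    EqSp-rename (eqcons e es) = eqcons (EqTm-rename e) (EqSp-rename es)
    EqSp-rename (eqpre es) = eqpre (EqSp-rename es)

  TyEq-rename : TyEq Sg A A' → TyEq Sg (renameTy f A) (renameTy f A')
  TyEq-rename (atom e) = atom (λ n → EqSp-rename (e n))
  TyEq-rename (Πt e e') = Πt (TyEq-rename e) (TyEq-rename e')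
  TyEq-rename (Πp e e') = Πp (TyEq-rename e) (TyEq-rename e')

  mutual
    EqTm-trans : EqTm Sg n M M' → EqTm Sg n M' R → EqTm Sg n M R
    EqTm-trans eq0 _ = eq0
    EqTm-trans (eqlam _) eq0 = eq0
    EqTm-trans (eqlam e) (eqlam e') = eqlam (EqTm-trans e e')
    EqTm-trans (eqhd u v e) (eqhd u' v' e') with Unfold-functional v u'
    ... | refl , refl = eqhd u v' (EqSp-trans e e')

    EqSp-trans : EqSp Sg n S S' → EqSp Sg n S' T → EqSp Sg n S T
    EqSp-trans eqnil eqnil = eqnil
    EqSp-trans (eqcons e es) (eqcons e' es') = eqcons (EqTm-trans e e') (EqSp-trans es es')
    EqSp-trans (eqpre es) (eqpre es') = eqpre (EqSp-trans es es')

  TyEq-trans : TyEq Sg A A' → TyEq Sg A' C → TyEq Sg A C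
  TyEq-trans (atom e) (atom e') = atom (λ n → EqSp-trans (e n) (e' n))
  TyEq-trans (Πt e₂ e₁) (Πt e₂' e₁') = Πt (TyEq-trans e₂ e₂') (TyEq-trans e₁ e₁')
  TyEq-trans (Πp e₂ e₁) (Πp e₂' e₁') = Πp (TyEq-trans e₂ e₂') (TyEq-trans e₁ e₁')

  -- Simple typing makes the reduction of the body defined; contractivity makes one unfolding enough
  -- to reach a head that is not a recursion constant.
  SHead-unfold : SHead Sg Φ H ρ → SSp Sg Φ S ρ →
    ∃[ h ] ∃[ T ] ∃[ ρ' ] (Unfold Sg H S h T × SSp Sg Φ T ρ')
  SHead-unfold (var x) s = _ , _ , _ , var , s
  SHead-unfold (pvar x) s = _ , _ , _ , var , s
  SHead-unfold (con m) s = _ , _ , _ , con , s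
  SHead-unfold {Φ = Φ} (rec {A = A} {M} m) s
    -- The choice of `suc` is arbitrary: every map is a renaming out of the empty context and fixes
    -- the closed body.
    with SCheck-reduce (skel A) (subst (λ L → SCheck Sg Φ L (skel A)) (rdef-closed suc m)
           (SCheck-rename (SRen-empty {suc}) (rdef-body m))) s
  ... | h · T , r , _ · t with Contractive-reduce (SSp-OnlyPre (rdef-pre m) s) (rdef-contract m) r
  ...   | cthd nr = h , T , _ ,
    rec m (reduce-complete (subst (λ τ → Red τ _ M (h · T)) (sym (erase-skel A)) r)) nr , t

  mutual
    -- An unfolded spine is no smaller than the original one, so the depth, which drops at each
    -- head, is the primary measure, and the derivation the secondary one.
    EqTm-refl : ∀ n → SCheck Sg Φ M ρ → EqTm Sg n M M
    EqTm-refl zero d = eq0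
    EqTm-refl (suc n) (lamₒ d) = eqlam (EqTm-refl (suc n) d)
    EqTm-refl (suc n) (lamₚ d) = eqlam (EqTm-refl (suc n) d)
    EqTm-refl (suc n) (h · s) with SHead-unfold h s
    ... | _ , _ , _ , u , t = eqhd u u (EqSp-refl n t)

    EqSp-refl : ∀ n → SSp Sg Φ S ρ → EqSp Sg n S S
    EqSp-refl n ε = eqnil
    EqSp-refl n (d ∷ s) = eqcons (EqTm-refl n d) (EqSp-refl n s)
    EqSp-refl n ([ x ]∷ s) = eqpre (EqSp-refl n s)

  TyEq-refl : SWf Sg Φ A → TyEq Sg A A
  TyEq-refl (atom s) = atom (λ n → EqSp-refl n s)
  TyEq-refl (Πt w w') = Πt (TyEq-refl w) (TyEq-refl w')
  TyEq-refl (Πp w w') = Πp (TyEq-refl w) (TyEq-refl w')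

  -- The equation for `h` says that the exposed head is not the replaced variable, so it survives
  -- substitution. For a recursion constant the spine is only strengthened, and unfolding commutes
  -- with that.
  Unfold-sub : (∀ i → Ins k i (f i)) → RecPreTm (H · S) → SubTm τ N k (H · S) M' →
    ∀ h₀ {h} → h ≡ renameH f h₀ → Unfold Sg H S h T →
    ∃[ H₁ ] ∃[ S₁ ] ∃[ T₁ ] (M' ≡ H₁ · S₁ × Unfold Sg H₁ S₁ h₀ T₁ × SubSp τ N k T T₁)
  Unfold-sub p _ (var≠ q d) (var i) refl var with Ins-injective q (p i)
  ... | refl = _ , _ , _ , refl , var , d
  Unfold-sub p _ (var= d r) (var i) refl var = ⊥-elim (Ins-irrefl (p i))
  Unfold-sub p _ (con d) (con c) refl con = _ , _ , _ , refl , con , d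
  Unfold-sub {f = f} p (rec o) (rec d) h₀ h≡ u with OnlyPre-sub p o d
  ... | refl , o' with Unfold-rename⁻¹ {f = f} (rec _) (rec o') u
  ...   | h₁ , T₁ , h≡' , refl , u' with renameH-injective p h₁ h₀ (trans (sym h≡') h≡)
  ...     | refl = _ , _ , _ , refl , u' , SubSp-cancel p T₁

  -- If the variable does not occur in M, no depth of agreement is lost.
  mutual
    EqTm-strengthen : (∀ i → Ins k i (f i)) → ∀ M → RecPreTm M → RecPreTm M' →
      SubTm τ N k M' R → EqTm Sg n (renameTm f M) M' → EqTm Sg n M R
    EqTm-strengthen p (lam M) m m' d eq0 = eq0
    EqTm-strengthen p (lam M) (lam m) (lam m') (lam d) (eqlam e) =
      eqlam (EqTm-strengthen (Ins-lift p) M m m' d e)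
    EqTm-strengthen p (H · S) m m' d eq0 = eq0
    EqTm-strengthen p (H · S) m m' d (eqhd u v e) with Unfold-rename⁻¹ H m u
    ... | h₀ , T₀ , h≡ , refl , u₀ with Unfold-sub p m' d h₀ h≡ v
    ...   | _ , _ , _ , refl , v₁ , d' =
      eqhd u₀ v₁ (EqSp-strengthen p T₀ (Unfold-RecPre m u₀) (Unfold-RecPre m' v) d' e)

    EqSp-strengthen : (∀ i → Ins k i (f i)) → ∀ S → RecPreSp S → RecPreSp S' →
      SubSp τ N k S' T → EqSp Sg n (renameSp f S) S' → EqSp Sg n S T
    EqSp-strengthen p ε _ _ ε eqnil = eqnil
    EqSp-strengthen p (M ∷ S) (m ∷ s) (m' ∷ s') (d ∷ ds) (eqcons e es) =
      eqcons (EqTm-strengthen p M m m' d e) (EqSp-strengthen p S s s' ds es)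
    EqSp-strengthen p ([ y ]∷ S) ([ _ ]∷ s) ([ _ ]∷ s') ([ q ]∷ ds) (eqpre es) with Ins-injective q (p y)
    ... | refl = eqpre (EqSp-strengthen p S s s' ds es)

  -- The left side is a weakening by `OnlyPre-sub`, so its substituend is never inserted and need
  -- not be related to the one on the right.
  rec-strengthen : OnlyPre S → RecPreTm M' → SubSp τ N' k S S' → SubTm τ N k M' R →
    TmEq Sg (rec r · S) M' → TmEq Sg (rec r · S') R
  rec-strengthen {k = k} o m' ds d e n with OnlyPre-sub (Ins-punch k) o ds
  ... | refl , o' = EqTm-strengthen (Ins-punch k) (rec _ · _) (rec o') m' d (e n)

  -- A head replaced by N costs depth, so agreement at all depths is needed;
  -- below a recursion constant the variable does not occur.
  mutual
    TmEq-sub : ∀ {M₁ M₁'} → RecPreTm N → RecPreTm N' → TmEq Sg N N' →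
      RecPreTm M → RecPreTm M' → TmEq Sg M M' →
      SubTm τ N k M M₁ → SubTm τ N' k M' M₁' → TmEq Sg M₁ M₁'
    TmEq-sub n n' ν (rec o) m' e (rec ds) d' = rec-strengthen o m' ds d' e
    TmEq-sub n n' ν m (rec o) e d (rec ds) =
      λ i → EqTm-sym (rec-strengthen o m ds d (λ j → EqTm-sym (e j)) i)
    TmEq-sub n n' ν (lam m) (lam m') e (lam d) (lam d') =
      λ i → eqlam (TmEq-sub (RecPreTm-rename n) (RecPreTm-rename n') (λ j → EqTm-rename (ν j)) m m' (TmEq-lam e) d d' i)
    TmEq-sub n n' ν (var m) (var m') e (var≠ p d) (var≠ q d') with TmEq-spine tt tt e
    ... | refl , es with Ins-injective p q
    ...   | refl = λ { zero → eq0 ; (suc i) → eqhd var var (SpEq-sub n n' ν m m' es d d' i) }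
    TmEq-sub n n' ν (var m) (var m') e (var= d r) (var= d' r') with TmEq-spine tt tt e
    ... | refl , es = TmEq-reduce (RecPreSp-sub n m d) (RecPreSp-sub n' m' d') (SpEq-sub n n' ν m m' es d d') n n' ν r r'
    TmEq-sub n n' ν (con m) (con m') e (con d) (con d') with TmEq-spine tt tt e
    ... | refl , es = λ { zero → eq0 ; (suc i) → eqhd con con (SpEq-sub n n' ν m m' es d d' i) }
    TmEq-sub n n' ν m m' e (var≠ p d) (var= d' r') with TmEq-spine tt tt e
    ... | refl , _ = ⊥-elim (Ins-irrefl p)
    TmEq-sub n n' ν m m' e (var= d r) (var≠ q d') with TmEq-spine tt tt e
    ... | refl , _ = ⊥-elim (Ins-irrefl q)
    TmEq-sub n n' ν m m' e (var≠ p d) (con d') with TmEq-spine tt tt e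
    ... | () , _
    TmEq-sub n n' ν m m' e (var= d r) (con d') with TmEq-spine tt tt e
    ... | () , _
    TmEq-sub n n' ν m m' e (con d) (var≠ q d') with TmEq-spine tt tt e
    ... | () , _
    TmEq-sub n n' ν m m' e (con d) (var= d' r') with TmEq-spine tt tt e
    ... | () , _
    TmEq-sub n n' ν m m' e (lam d) (var≠ q d') with e 1
    ... | ()
    TmEq-sub n n' ν m m' e (lam d) (var= d' r') with e 1
    ... | ()
    TmEq-sub n n' ν m m' e (lam d) (con d') with e 1
    ... | ()
    TmEq-sub n n' ν m m' e (var≠ p d) (lam d') with e 1
    ... | ()
    TmEq-sub n n' ν m m' e (var= d r) (lam d') with e 1
    ... | ()
    TmEq-sub n n' ν m m' e (con d) (lam d') with e 1
    ... | ()

    SpEq-sub : ∀ {S₁ S₁'} → RecPreTm N → RecPreTm N' → TmEq Sg N N' →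
      RecPreSp S → RecPreSp S' → SpEq Sg S S' →
      SubSp τ N k S S₁ → SubSp τ N' k S' S₁' → SpEq Sg S₁ S₁'
    SpEq-sub n n' ν ε ε e ε ε = e
    SpEq-sub n n' ν (m ∷ s) (m' ∷ s') e (d ∷ ds) (d' ∷ ds') = λ i →
      eqcons (TmEq-sub n n' ν m m' (SpEq-head e) d d' i) (SpEq-sub n n' ν s s' (SpEq-tail e) ds ds' i)
    SpEq-sub n n' ν ([ _ ]∷ s) ([ _ ]∷ s') e ([ p ]∷ ds) ([ q ]∷ ds') with SpEq-pre e
    ... | refl , es with Ins-injective p q
    ...   | refl = λ i → eqpre (SpEq-sub n n' ν s s' es ds ds' i)
    SpEq-sub n n' ν s s' e ε (_ ∷ _) with e 0
    ... | ()
    SpEq-sub n n' ν s s' e ε ([ _ ]∷ _) with e 0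
    ... | ()
    SpEq-sub n n' ν s s' e (_ ∷ _) ε with e 0
    ... | ()
    SpEq-sub n n' ν s s' e (_ ∷ _) ([ _ ]∷ _) with e 0
    ... | ()
    SpEq-sub n n' ν s s' e ([ _ ]∷ _) ε with e 0
    ... | ()
    SpEq-sub n n' ν s s' e ([ _ ]∷ _) (_ ∷ _) with e 0
    ... | ()

    TmEq-reduce : ∀ {R₁ R₁'} → RecPreSp S → RecPreSp S' → SpEq Sg S S' →
      RecPreTm R → RecPreTm R' → TmEq Sg R R' →
      Red τ S R R₁ → Red τ S' R' R₁' → TmEq Sg R₁ R₁'
    TmEq-reduce s s' e m m' e' ε ε = e'
    TmEq-reduce (n ∷ s) (n' ∷ s') e (lam m) (lam m') e' (d ∷ r) (d' ∷ r') =
      TmEq-reduce s s' (SpEq-tail e) (RecPreTm-sub n m d) (RecPreTm-sub n' m' d')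
        (TmEq-sub n n' (SpEq-head e) m m' (TmEq-lam e') d d') r r'
    TmEq-reduce ([ _ ]∷ s) ([ _ ]∷ s') e (lam m) (lam m') e' ([ y ]∷ r) ([ y' ]∷ r') with SpEq-pre e
    ... | refl , es = TmEq-reduce s s' es (RecPreTm-rename m) (RecPreTm-rename m')
        (λ i → EqTm-rename (TmEq-lam e' i)) r r'
    TmEq-reduce s s' e m m' e' (_ ∷ _) ([ _ ]∷ _) with e 0
    ... | ()
    TmEq-reduce s s' e m m' e' ([ _ ]∷ _) (_ ∷ _) with e 0
    ... | ()

  TyEq-sub : ∀ {A₁ A₁'} → RecPreTm N → TmEq Sg N N →
    RecPreTy A → RecPreTy A' → TyEq Sg A A' →
    SubTy τ N k A A₁ → SubTy τ N k A' A₁' → TyEq Sg A₁ A₁'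
  TyEq-sub n ν (atom s) (atom s') (atom e) (atom d) (atom d') = atom (SpEq-sub n n ν s s' e d d')
  TyEq-sub n ν (Πt a₂ a₁) (Πt b₂ b₁) (Πt e₂ e₁) (Πt d₂ d₁) (Πt d₂' d₁') =
    Πt (TyEq-sub n ν a₂ b₂ e₂ d₂ d₂')
      (TyEq-sub (RecPreTm-rename n) (λ i → EqTm-rename (ν i)) a₁ b₁ e₁ d₁ d₁')
  TyEq-sub n ν (Πp a₂ a₁) (Πp b₂ b₁) (Πp e₂ e₁) (Πp d₂ d₁) (Πp d₂' d₁') =
    Πp (TyEq-sub n ν a₂ b₂ e₂ d₂ d₂')
      (TyEq-sub (RecPreTm-rename n) (λ i → EqTm-rename (ν i)) a₁ b₁ e₁ d₁ d₁')

-- From typing to simple typing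

skel-ren : ∀ y k A → skel (renTy y k A) ≡ skel A
skel-ren y k (atom a S) = refl
skel-ren y k (Πt A₂ A₁) = cong₂ _→ₒ_ (skel-ren y k A₂) (skel-ren y (suc k) A₁)
skel-ren y k (Πp A₂ A₁) = cong₂ _→ₚ_ (skel-ren y k A₂) (skel-ren y (suc k) A₁)

skel-subst : ∀ τ N k A → substTy τ N k A ≡ just A' → skel A ≡ skel A'
skel-subst τ N k A p = skel-SubTy (substTy-sound τ N k A p)

skelKi : Ki → Skel
skelKi type = ⋆
skelKi cotype = ⋆
skelKi (Πk A K) = skel A →ₒ skelKi K
skelKi (Πkp A K) = skel A →ₚ skelKi K

skelKi-ren : ∀ y k K → skelKi (renKi y k K) ≡ skelKi K
skelKi-ren y k type = refl
skelKi-ren y k cotype = refl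
skelKi-ren y k (Πk A K) = cong₂ _→ₒ_ (skel-ren y k A) (skelKi-ren y (suc k) K)
skelKi-ren y k (Πkp A K) = cong₂ _→ₚ_ (skel-ren y k A) (skelKi-ren y (suc k) K)

skelKi-subst : ∀ τ N k K {K'} → substKi τ N k K ≡ just K' → skelKi K ≡ skelKi K'
skelKi-subst τ N k type refl = refl
skelKi-subst τ N k cotype refl = refl
skelKi-subst τ N k (Πk A K) p with just-map₂ Πk (substTy τ N k A) (substKi τ N (suc k) K) p
... | _ , _ , q , q' , refl = cong₂ _→ₒ_ (skel-subst τ N k A q) (skelKi-subst τ N (suc k) K q')
skelKi-subst τ N k (Πkp A K) p with just-map₂ Πkp (substTy τ N k A) (substKi τ N (suc k) K) p
... | _ , _ , q , q' , refl = cong₂ _→ₚ_ (skel-subst τ N k A q) (skelKi-subst τ N (suc k) K q')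

skelEntry-shift : ∀ e → skelEntry (shiftEntry 0 1 e) ≡ skelEntry e
skelEntry-shift e = trans (cong skelEntry (shiftEntry-suc e)) (skelEntry-rename suc e)

lookup-skel : Γ ∋ i ⦂ e → skelCtx Γ ∋ˢ i ⦂ skelEntry e
lookup-skel {Γ = e ∷ Γ} here = subst (skelCtx (e ∷ Γ) ∋ˢ 0 ⦂_) (sym (skelEntry-shift e)) here
lookup-skel (there {e = e} x) = subst (_ ∋ˢ _ ⦂_) (sym (skelEntry-shift e)) (there (lookup-skel x))

lookup-skel⁻¹ : skelCtx Γ ∋ˢ i ⦂ η → ∃[ e ] (Γ ∋ i ⦂ e × skelEntry e ≡ η)
lookup-skel⁻¹ {Γ = e ∷ _} here = _ , here , skelEntry-shift e
lookup-skel⁻¹ {Γ = _ ∷ _} (there x) with lookup-skel⁻¹ x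
... | e , z , refl = _ , there z , skelEntry-shift e

SWfCtx : Sig → Ctx → Set
SWfCtx Sg Γ = ∀ {i e} → Γ ∋ i ⦂ e → SWf Sg (skelCtx Γ) (entryTy e)

SWf-shift : ∀ e {η} → SWf Sg Φ (entryTy e) → SWf Sg (η ∷ Φ) (entryTy (shiftEntry 0 1 e))
SWf-shift e w = subst (λ e → SWf _ _ (entryTy e)) (sym (shiftEntry-suc e)) (rename-entry e w)
  where
  rename-entry : ∀ e {η} → SWf Sg Φ (entryTy e) → SWf Sg (η ∷ Φ) (entryTy (renameEntry suc e))
  rename-entry (ord A) = SWf-rename there
  rename-entry (pre A) = SWf-rename there

SWfCtx-∷ : SWfCtx Sg Γ → SWf Sg (skelCtx Γ) (entryTy e) → SWfCtx Sg (e ∷ Γ)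
SWfCtx-∷ {e = e} γ w here = SWf-shift e w
SWfCtx-∷ γ w (there {e = e} x) = SWf-shift e (γ x)

module Simple (m : Mode) (Ξ Sg : Sig) (Ξ⊆Sg : ∀ {d} → d ∈ Ξ → d ∈ Sg) where
  open Typing m Ξ Sg

  HeadTy-simple : HeadTy Γ H A → SHead Sg (skelCtx Γ) H (skel A)
  HeadTy-simple (hvar x) = var (lookup-skel x)
  HeadTy-simple (hpvar x) = pvar (lookup-skel x)
  HeadTy-simple (hcon m) = con (Ξ⊆Sg m)
  HeadTy-simple (hrec m) = rec (Ξ⊆Sg m)
  HeadTy-simple (hrecΣ _ m) = rec m

  mutual
    Check-simple : Check Γ M A → SCheck Sg (skelCtx Γ) M (skel A)
    Check-simple (clam c) = lamₒ (Check-simple c)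
    Check-simple (clamp c) = lamₚ (Check-simple c)
    Check-simple (catom (shd h s) _) = HeadTy-simple h · SpTy-simple s

    SpTy-simple : SpTy Γ S A P → SSp Sg (skelCtx Γ) S (skel A)
    SpTy-simple snil = ε
    SpTy-simple (scons {M} {A₂ = A₂} {A₁} c p s) =
      Check-simple c ∷ subst (SSp Sg _ _) (sym (skel-subst (erase A₂) M 0 A₁ p)) (SpTy-simple s)
    SpTy-simple (spre {y} {A₁ = A₁} x e s) =
      [ subst (λ ρ → _ ∋ˢ y ⦂ pre ρ) (skel-TyEq e) (lookup-skel x) ]∷
      subst (SSp Sg _ _) (skel-ren y 0 A₁) (SpTy-simple s)

  SpKi-simple : ∀ {K K'} → SpKi Γ S K K' → K' ≡ type ⊎ K' ≡ cotype → SSp Sg (skelCtx Γ) S (skelKi K)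
  SpKi-simple knil (inj₁ refl) = ε
  SpKi-simple knil (inj₂ refl) = ε
  SpKi-simple (kcons {M} {A₂ = A₂} {K} c p s) q =
    Check-simple c ∷ subst (SSp Sg _ _) (sym (skelKi-subst (erase A₂) M 0 K p)) (SpKi-simple s q)
  SpKi-simple (kpre {y} {K = K} x e s) q =
    [ subst (λ ρ → _ ∋ˢ y ⦂ pre ρ) (skel-TyEq e) (lookup-skel x) ]∷
    subst (SSp Sg _ _) (skelKi-ren y 0 K) (SpKi-simple s q)

  WfTy-simple : WfTy Γ A → SWf Sg (skelCtx Γ) A
  WfTy-simple (watom _ s q) = atom (SpKi-simple s q)
  WfTy-simple (wΠt w w') = Πt (WfTy-simple w) (WfTy-simple w')
  WfTy-simple (wΠp w w') = Πp (WfTy-simple w) (WfTy-simple w')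

  WfCtx-simple : WfCtx Γ → SWfCtx Sg Γ
  WfCtx-simple (ccons γ w) = SWfCtx-∷ (WfCtx-simple γ) (WfTy-simple w)

  SWf-scons : Check Γ M A₂ → SWf Sg (ord (skel A₂) ∷ skelCtx Γ) A₁ →
    SubTy (erase A₂) M 0 A₁ A' → SWf Sg (skelCtx Γ) A'
  SWf-scons {A₂ = A₂} c w d = SWf-sub₀ (Check-simple c) w (subst (λ τ → SubTy τ _ 0 _ _) (erase-skel A₂) d)

  SWf-spre : Γ ∋ y ⦂ pre A → TyEq Sg A A₂ → SWf Sg (pre (skel A₂) ∷ skelCtx Γ) A₁ →
    SWf Sg (skelCtx Γ) (renTy y 0 A₁)
  SWf-spre {y = y} {A₁ = A₁} x e w = subst (SWf Sg _) (sym (renTy-inst y A₁))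
    (SWf-rename (SRen-inst (subst (λ ρ → _ ∋ˢ y ⦂ pre ρ) (skel-TyEq e) (lookup-skel x))) w)

-- What a well-formed signature provides

DeclOK-fresh : ∀ Ξ d → DeclOK Sg Ξ d → Fresh (declName d) Ξ
DeclOK-fresh Ξ (fam a K) = proj₁
DeclOK-fresh Ξ (cst c A) = proj₁
DeclOK-fresh Ξ (rdef r A M) = proj₁

-- Freshness looks only at earlier declarations: of two different ones with the same name, the later
-- would violate its own freshness condition.
declName-injective : ∀ {d d'} → SigOK Sg → d ∈ Sg → d' ∈ Sg → declName d ≡ declName d' → d ≡ d'
declName-injective {Sg} ok x y = in-suffix [] _ refl x y
  where
  later : ∀ Ξ Sg' {d d'} → Sg ≡ Ξ ++ d ∷ Sg' → d' ∈ Sg' → declName d ≢ declName d'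
  later Ξ Sg' {d} {d'} p x e with ∈-∃++ x
  ... | Ξ' , rest , refl = lookup
    (DeclOK-fresh (Ξ ++ d ∷ Ξ') d' (ok (Ξ ++ d ∷ Ξ') d' rest (trans p (sym (++-assoc Ξ (d ∷ Ξ') (d' ∷ rest))))))
    (∈-++⁺ʳ Ξ (here refl)) e

  in-suffix : ∀ Ξ Sg' {d d'} → Sg ≡ Ξ ++ Sg' → d ∈ Sg' → d' ∈ Sg' → declName d ≡ declName d' → d ≡ d'
  in-suffix Ξ _ p (here refl) (here refl) e = refl
  in-suffix Ξ _ p (here refl) (there y) e = ⊥-elim (later Ξ _ p y e)
  in-suffix Ξ _ p (there x) (here refl) e = ⊥-elim (later Ξ _ p x (sym e))
  in-suffix Ξ (d ∷ Sg') p (there x) (there y) e =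
    in-suffix (Ξ ++ d ∷ []) Sg' (trans p (sym (++-assoc Ξ (d ∷ []) Sg'))) x y e

SigOK-simple : SigOK Sg → SimpleSig Sg
SigOK-simple {Sg} ok = record
  { rdef-unique = λ x y → rdef-injective (declName-injective ok x y refl)
  ; cst-wf = cst-wf
  ; rdef-wf = λ x → proj₁ (rdef-ok x)
  ; rdef-pre = λ x → proj₁ (proj₂ (rdef-ok x))
  ; rdef-contract = λ x → proj₁ (proj₂ (proj₂ (rdef-ok x)))
  ; rdef-body = λ x → proj₂ (proj₂ (proj₂ (rdef-ok x)))
  }
  where
  rdef-injective : ∀ {r A M A' M'} → Decl.rdef r A M ≡ rdef r A' M' → A ≡ A' × M ≡ M'
  rdef-injective refl = refl , refl

  cst-wf : ∀ {c A} → cst c A ∈ Sg → SWf Sg [] A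
  cst-wf x with ∈-∃++ x
  ... | Ξ , rest , p with ok Ξ _ rest p
  ...   | _ , w = Simple.WfTy-simple plain Ξ Sg (λ y → subst (_ ∈_) (sym p) (∈-++⁺ˡ y)) w

  rdef-ok : ∀ {r A M} → rdef r A M ∈ Sg → SWf Sg [] A × AllPre A × Contractive M × SCheck Sg [] M (skel A)
  rdef-ok x with ∈-∃++ x
  ... | Ξ , rest , p with ok Ξ _ rest p
  ...   | _ , w , a , t , _ , b = Simple.WfTy-simple plain Ξ Sg Ξ⊆Sg w , a , t , Simple.Check-simple body Ξ Sg Ξ⊆Sg b
    where
    Ξ⊆Sg : ∀ {d} → d ∈ Ξ → d ∈ Sg
    Ξ⊆Sg y = subst (_ ∈_) (sym p) (∈-++⁺ˡ y)

-- Substitution and typing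

data EntryEq (Sg : Sig) : Entry → Entry → Set where
  ord : TyEq Sg A A' → EntryEq Sg (ord A) (ord A')
  pre : TyEq Sg A A' → EntryEq Sg (pre A) (pre A')

renameEntry-inst-shift : ∀ y e → renameEntry (inst y) (shiftEntry 0 1 e) ≡ e
renameEntry-inst-shift y e = trans (cong (renameEntry (inst y)) (shiftEntry-suc e)) (unshift e)
  where
  unshift : ∀ e → renameEntry (inst y) (renameEntry suc e) ≡ e
  unshift (ord A) = cong ord (trans (renameTy-∘ (λ _ → refl) A) (renameTy-id (λ _ → refl) A))
  unshift (pre A) = cong pre (trans (renameTy-∘ (λ _ → refl) A) (renameTy-id (λ _ → refl) A))

SubEntry-shift : SubEntry τ N k e e' → SubEntry τ (renameTm suc N) (suc k) (shiftEntry 0 1 e) (shiftEntry 0 1 e')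
SubEntry-shift {e = e} {e'} d rewrite shiftEntry-suc e | shiftEntry-suc e' = SubEntry-suc d

SubEntry-unshift : ∀ e → SubEntry τ N 0 (shiftEntry 0 1 e) e
SubEntry-unshift e rewrite shiftEntry-suc e = SubEntry-cancel (λ _ → zero) e

RecPreTy-rename : RecPreTy A → RecPreTy (renameTy f A)
RecPreTy-rename (atom p) = atom (RecPreSp-rename p)
RecPreTy-rename (Πt p q) = Πt (RecPreTy-rename p) (RecPreTy-rename q)
RecPreTy-rename (Πp p q) = Πp (RecPreTy-rename p) (RecPreTy-rename q)

⇒-injective : ∀ {σ σ' τ τ'} → (σ ⇒ τ) ≡ (σ' ⇒ τ') → σ ≡ σ' × τ ≡ τ'
⇒-injective refl = refl , refl

SWf-sub-erase : ∀ A₀ → SSub k (skel A₀) Φ Ψ → SCheck Sg Ψ N (skel A₀) → SWf Sg Φ A →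
  ∃[ A' ] (SubTy (erase A₀) N k A A' × SWf Sg Ψ A')
SWf-sub-erase A₀ s n w rewrite erase-skel A₀ = SWf-sub s n w

SCheck-sub-erase : ∀ A₀ → SSub k (skel A₀) Φ Ψ → SCheck Sg Ψ N (skel A₀) → SCheck Sg Φ M ρ →
  ∃[ M' ] (SubTm (erase A₀) N k M M' × SCheck Sg Ψ M' ρ)
SCheck-sub-erase A₀ s n d rewrite erase-skel A₀ = SCheck-sub (skel A₀) s n d

module Substitution (m : Mode) (Ξ Sg : Sig) (Ξ⊆Sg : ∀ {d} → d ∈ Ξ → d ∈ Sg) (ok : SimpleSig Sg) where
  open Typing m Ξ Sg
  open Simple m Ξ Sg Ξ⊆Sg
  open SimpleSig ok
  open Equality ok

  EntryEq-rename : EntryEq Sg e e' → EntryEq Sg (renameEntry f e) (renameEntry f e')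
  EntryEq-rename (ord p) = ord (TyEq-rename p)
  EntryEq-rename (pre p) = pre (TyEq-rename p)

  EntryEq-refl : ∀ e → SWf Sg Φ (entryTy e) → EntryEq Sg e e
  EntryEq-refl (ord A) w = ord (TyEq-refl w)
  EntryEq-refl (pre A) w = pre (TyEq-refl w)

  Ren : (ℕ → ℕ) → Ctx → Ctx → Set
  Ren f Γ Δ = ∀ {i e} → Γ ∋ i ⦂ e → ∃[ e' ] (EntryEq Sg (renameEntry f e) e' × Δ ∋ f i ⦂ e')

  EntryEq-shift : EntryEq Sg (renameEntry f e) e' → EntryEq Sg (renameEntry (lift f) (shiftEntry 0 1 e)) (shiftEntry 0 1 e')
  EntryEq-shift {f} {e} {e'} p = subst (λ e₀ → EntryEq Sg (renameEntry (lift f) e₀) _) (sym (shiftEntry-suc e))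
    (subst (λ e₁ → EntryEq Sg e₁ _) (renameEntry-square (λ _ → refl) e)
      (subst (EntryEq Sg _) (sym (shiftEntry-suc e')) (EntryEq-rename p)))

  Ren-lift : Ren f Γ Δ → EntryEq Sg (renameEntry f e) e' → Ren (lift f) (e ∷ Γ) (e' ∷ Δ)
  Ren-lift p q here = _ , EntryEq-shift q , here
  Ren-lift p q (there x) with p x
  ... | _ , q' , z = _ , EntryEq-shift q' , there z

  Ren-suc : SWfCtx Sg Γ → Ren suc Γ (e ∷ Γ)
  Ren-suc γ {e = e} x = _ ,
    subst (EntryEq Sg _) (sym (shiftEntry-suc e)) (EntryEq-rename (EntryEq-refl e (γ x))) , there x

  Ren-id : SWfCtx Sg Γ → Ren (λ i → i) Γ Γ
  Ren-id γ {e = ord A} x = _ , ord (subst (λ B → TyEq Sg B A) (sym (renameTy-id (λ _ → refl) A)) (TyEq-refl (γ x))) , x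
  Ren-id γ {e = pre A} x = _ , pre (subst (λ B → TyEq Sg B A) (sym (renameTy-id (λ _ → refl) A)) (TyEq-refl (γ x))) , x

  -- The rule for prepattern arguments asks only for equal types, so replacing a bound variable by
  -- `y` may change its declared type. This forces renamings to respect types only up to equality.
  Ren-inst : SWfCtx Sg Γ → Γ ∋ y ⦂ pre A → TyEq Sg A A' → Ren (inst y) (pre A' ∷ Γ) Γ
  Ren-inst {y = y} {A} {A'} γ x p here = _ ,
    subst (λ e → EntryEq Sg e (pre A)) (sym (renameEntry-inst-shift y (pre A'))) (pre (TyEq-sym p)) , x
  Ren-inst {y = y} γ x p (there {e = e} z) = _ ,
    subst (λ e' → EntryEq Sg e' e) (sym (renameEntry-inst-shift y e)) (EntryEq-refl e (γ z)) , z

  SWf-closed : SWf Sg [] A → SWf Sg Φ A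
  SWf-closed w = subst (SWf Sg _) (SWf-fixed (Fixes-empty {suc}) w) (SWf-rename (SRen-empty {suc}) w)

  HeadTy-wf : SWfCtx Sg Γ → HeadTy Γ H A → SWf Sg (skelCtx Γ) A
  HeadTy-wf γ (hvar x) = γ x
  HeadTy-wf γ (hpvar x) = γ x
  HeadTy-wf γ (hcon x) = SWf-closed (cst-wf (Ξ⊆Sg x))
  HeadTy-wf γ (hrec x) = SWf-closed (rdef-wf (Ξ⊆Sg x))
  HeadTy-wf γ (hrecΣ _ x) = SWf-closed (rdef-wf x)

  TyEq-closed : SWf Sg [] A → TyEq Sg (renameTy f A) A
  TyEq-closed {f = f} w = subst (λ B → TyEq Sg B _) (sym (SWf-fixed (Fixes-empty {f}) w)) (TyEq-refl w)

  HeadTy-rename : Ren f Γ Δ → HeadTy Γ H A →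
    ∃[ A' ] (HeadTy Δ (renameH f H) A' × TyEq Sg (renameTy f A) A')
  HeadTy-rename p (hvar x) with p x
  ... | _ , ord q , z = _ , hvar z , q
  HeadTy-rename p (hpvar x) with p x
  ... | _ , pre q , z = _ , hpvar z , q
  HeadTy-rename p (hcon x) = _ , hcon x , TyEq-closed (cst-wf (Ξ⊆Sg x))
  HeadTy-rename p (hrec x) = _ , hrec x , TyEq-closed (rdef-wf (Ξ⊆Sg x))
  HeadTy-rename p (hrecΣ b x) = _ , hrecΣ b x , TyEq-closed (rdef-wf x)

  TyEq-inst : ∀ f y A A' → TyEq Sg (renameTy (lift f) A) A' →
    TyEq Sg (renameTy f (renTy y 0 A)) (renTy (f y) 0 A')
  TyEq-inst f y A A' e rewrite renTy-inst y A | renTy-inst (f y) A' =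
    subst (λ C → TyEq Sg C _) (sym (renameTy-square (inst-lift f y) A)) (TyEq-rename e)

  -- Renaming and conversion (of the type and of the context) in one statement,
  -- since Ren relates the types of variables only up to equality.
  mutual
    Check-rename : Ren f Γ Δ → SWfCtx Sg Γ → SWfCtx Sg Δ →
      SWf Sg (skelCtx Γ) A → SWf Sg (skelCtx Δ) A' → TyEq Sg (renameTy f A) A' →
      Check Γ M A → Check Δ (renameTm f M) A'
    Check-rename p γ δ (Πt w₂ w₁) (Πt v₂ v₁) (Πt e₂ e₁) (clam c) =
      clam (Check-rename (Ren-lift p (ord e₂)) (SWfCtx-∷ γ w₂) (SWfCtx-∷ δ v₂) w₁ v₁ e₁ c)
    Check-rename p γ δ (Πp w₂ w₁) (Πp v₂ v₁) (Πp e₂ e₁) (clamp c) =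
      clamp (Check-rename (Ren-lift p (pre e₂)) (SWfCtx-∷ γ w₂) (SWfCtx-∷ δ v₂) w₁ v₁ e₁ c)
    Check-rename p γ δ w v (atom e) (catom (shd h s) q) with HeadTy-rename p h
    ... | _ , h' , e' with SpTy-rename p γ δ (HeadTy-wf γ h) (HeadTy-wf δ h') e' s
    ...   | _ , s' , q' = catom (shd h' s') (TyEq-trans (TyEq-sym q') (TyEq-trans (TyEq-rename q) (atom e)))

    SpTy-rename : Ren f Γ Δ → SWfCtx Sg Γ → SWfCtx Sg Δ →
      SWf Sg (skelCtx Γ) A → SWf Sg (skelCtx Δ) A' → TyEq Sg (renameTy f A) A' →
      SpTy Γ S A P → ∃[ P' ] (SpTy Δ (renameSp f S) A' P' × TyEq Sg (renameTy f P) P')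
    SpTy-rename p γ δ w v (atom e) snil = _ , snil , atom e
    SpTy-rename {f} {A' = Πt A₂' A₁'} p γ δ (Πt w₂ w₁) (Πt v₂ v₁) (Πt e₂ e₁) (scons {A₂ = A₂} c q s)
      with Check-rename p γ δ w₂ v₂ e₂ c | substTy₀-sound q
    ... | c' | d with SWf-sub-erase A₂' SSub-zero (Check-simple c') v₁
    ...   | A' , d' , v'
      with SpTy-rename p γ δ (SWf-scons c w₁ d) v'
        -- Both codomains are instantiated by the renamed argument. On the left this is the renaming
        -- of the given instance; on the right the instance exists by simple typing, and the
        -- annotations agree because renaming and equality preserve skeletons.
        (TyEq-sub (SCheck-RecPre (Check-simple c')) (λ n → EqTm-refl n (Check-simple c'))
          (RecPreTy-rename (SWf-RecPre w₁)) (SWf-RecPre v₁) e₁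
          (SubTy-rename 0 refl (λ { zero → zero }) d)
          (subst (λ τ → SubTy τ _ 0 A₁' A') (skel-erase (trans (sym (skel-TyEq e₂)) (skel-rename f A₂))) d')) s
    ...     | P' , s' , e' = P' , scons c' (substTy₀-complete d') s' , e'
    SpTy-rename {f} p γ δ (Πp w₂ w₁) (Πp v₂ v₁) (Πp {B₁ = A₁'} e₂ e₁) (spre {y} {A₁ = A₁} x q s) with p x
    ... | _ , pre e , z
      with q' ← TyEq-trans (TyEq-sym e) (TyEq-trans (TyEq-rename q) e₂)
      with SpTy-rename p γ δ (SWf-spre x q w₁) (SWf-spre z q' v₁) (TyEq-inst f y A₁ A₁' e₁) s
    ...   | P' , s' , e' = P' , spre z q' s' , e'

  Check-convert : SWfCtx Sg Γ → SWf Sg (skelCtx Γ) A → SWf Sg (skelCtx Γ) A' → TyEq Sg A A' →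
    Check Γ M A → Check Γ M A'
  Check-convert {A = A} {M = M} γ w v e c = subst (λ L → Check _ L _) (renameTm-id (λ _ → refl) M)
    (Check-rename (Ren-id γ) γ γ w v (subst (λ B → TyEq Sg B _) (sym (renameTy-id (λ _ → refl) A)) e) c)

  Check-suc : SWfCtx Sg Γ → SWf Sg (skelCtx Γ) (entryTy e) → SWf Sg (skelCtx Γ) A →
    Check Γ M A → Check (e ∷ Γ) (renameTm suc M) (renameTy suc A)
  Check-suc γ w v = Check-rename (Ren-suc γ) γ (SWfCtx-∷ γ w) v (SWf-rename there v) (TyEq-rename (TyEq-refl v))

  -- The type `A` found at the removed index lives in `Θ`, whereas `N` lives in `Δ`; its type there
  -- is therefore `A'`, the result of substituting in `A`.
  Sub : STy → Tm → ℕ → Ctx → Ctx → Set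
  Sub τ N k Θ Δ = ∀ {i e} → Θ ∋ i ⦂ e →
    (i ≡ k × ∃[ A ] ∃[ A' ] (e ≡ ord A × SubTy τ N k A A' × erase A' ≡ τ × SWf Sg (skelCtx Δ) A' × Check Δ N A'))
    ⊎ ∃[ i' ] ∃[ e' ] (Ins k i' i × SubEntry τ N k e e' × Δ ∋ i' ⦂ e')

  Sub-zero : erase A ≡ τ → SWf Sg (skelCtx Γ) A → Check Γ N A → Sub τ N 0 (ord A ∷ Γ) Γ
  Sub-zero {A = A} p w c here with SubEntry-unshift (ord A)
  ... | ord d = inj₁ (refl , _ , _ , refl , d , p , w , c)
  Sub-zero p w c (there {e = e} x) = inj₂ (_ , _ , zero , SubEntry-unshift e , x)

  Sub-suc : SWfCtx Sg Δ → SWf Sg (skelCtx Δ) (entryTy e') → SubEntry τ N k e e' → Sub τ N k Θ Δ →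
    Sub τ (renameTm suc N) (suc k) (e ∷ Θ) (e' ∷ Δ)
  Sub-suc δ w d s here = inj₂ (_ , _ , suc₀ , SubEntry-shift d , here)
  Sub-suc δ w d s (there x) with s x
  ... | inj₂ (_ , _ , p , d' , z) = inj₂ (_ , _ , suc p , SubEntry-shift d' , there z)
  ... | inj₁ (refl , A , A' , refl , d' , q , v , c) = inj₁ (refl , _ , _ ,
    shiftEntry-suc (ord A) , SubTy-suc d' , trans (skel-erase (skel-rename suc A')) q ,
    SWf-rename there v , Check-suc δ w v c)

  SubTy-closed : SWf Sg [] A → SubTy τ N k A A
  SubTy-closed {A = A} {k = k} w =
    subst (λ B → SubTy _ _ k B A) (SWf-fixed (Fixes-empty {punch k}) w) (SubTy-cancel (Ins-punch k) A)

  TyEq-sub-simple : SCheck Sg (skelCtx Δ) N ρ → SWf Sg (skelCtx Θ) A → SWf Sg (skelCtx Θ) C → TyEq Sg A C →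
    SubTy τ N k A A' → SubTy τ N k C P → TyEq Sg A' P
  TyEq-sub-simple n w v = TyEq-sub (SCheck-RecPre n) (λ i → EqTm-refl i n) (SWf-RecPre w) (SWf-RecPre v)

  mutual
    -- `Sub` reveals a typing of `N` only at an occurrence of the variable, while transport of type
    -- equality needs `N` to be equal to itself everywhere; hence the separate simple typing of `N`.
    Check-sub : ∀ τ → Sub τ N k Θ Δ → SWfCtx Sg Θ → SWfCtx Sg Δ → SCheck Sg (skelCtx Δ) N ρ →
      SWf Sg (skelCtx Θ) A → SWf Sg (skelCtx Δ) A' → SubTm τ N k M M' → SubTy τ N k A A' →
      Check Θ M A → Check Δ M' A'
    Check-sub τ s θ δ n (Πt w₂ w₁) (Πt v₂ v₁) (lam d) (Πt a₂ a₁) (clam c) =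
      clam (Check-sub τ (Sub-suc δ v₂ (ord a₂) s) (SWfCtx-∷ θ w₂) (SWfCtx-∷ δ v₂) (SCheck-rename there n) w₁ v₁ d a₁ c)
    Check-sub τ s θ δ n (Πp w₂ w₁) (Πp v₂ v₁) (lam d) (Πp a₂ a₁) (clamp c) =
      clamp (Check-sub τ (Sub-suc δ v₂ (pre a₂) s) (SWfCtx-∷ θ w₂) (SWfCtx-∷ δ v₂) (SCheck-rename there n) w₁ v₁ d a₁ c)
    Check-sub τ s θ δ n w v (var≠ p d) (atom a) (catom (shd (hvar x) t) e) with s x
    ... | inj₁ (refl , _) = ⊥-elim (Ins-irrefl p)
    ... | inj₂ (_ , _ , q , ord b , z) with Ins-injective p q
    ...   | refl = Head-sub τ s θ δ n (hvar x) (hvar z) w v d b t (atom a) e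
    Check-sub τ s θ δ n w v (var≠ p d) (atom a) (catom (shd (hpvar x) t) e) with s x
    ... | inj₁ (_ , _ , _ , () , _)
    ... | inj₂ (_ , _ , q , pre b , z) with Ins-injective p q
    ...   | refl = Head-sub τ s θ δ n (hpvar x) (hpvar z) w v d b t (atom a) e
    Check-sub τ s θ δ n w v (var= d r) (atom a) (catom (shd (hvar x) t) e) with s x
    ... | inj₂ (_ , _ , q , _) = ⊥-elim (Ins-irrefl q)
    ... | inj₁ (_ , _ , A' , refl , b , q , u , c) with SpTy-sub τ s θ δ n (θ x) u d b t
    -- Reduction types the result by the substituted type of the spine. The equation that closed the
    -- atomic rule survives substitution and converts it to the expected type.
    ...   | P' , w' , v' , b' , t' = Check-convert δ v' v (TyEq-sub-simple n w' w e b' (atom a))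
            (Check-reduce τ q δ u c t' r)
    Check-sub τ s θ δ n w v (var= d r) (atom a) (catom (shd (hpvar x) t) e) with s x
    ... | inj₂ (_ , _ , q , _) = ⊥-elim (Ins-irrefl q)
    ... | inj₁ (_ , _ , _ , () , _)
    Check-sub τ s θ δ n w v (con d) (atom a) (catom (shd (hcon x) t) e) =
      Head-sub τ s θ δ n (hcon x) (hcon x) w v d (SubTy-closed (cst-wf (Ξ⊆Sg x))) t (atom a) e
    Check-sub τ s θ δ n w v (rec d) (atom a) (catom (shd (hrec x) t) e) =
      Head-sub τ s θ δ n (hrec x) (hrec x) w v d (SubTy-closed (rdef-wf (Ξ⊆Sg x))) t (atom a) e
    Check-sub τ s θ δ n w v (rec d) (atom a) (catom (shd (hrecΣ b x) t) e) =
      Head-sub τ s θ δ n (hrecΣ b x) (hrecΣ b x) w v d (SubTy-closed (rdef-wf x)) t (atom a) e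

    Head-sub : ∀ τ {S₁} → Sub τ N k Θ Δ → SWfCtx Sg Θ → SWfCtx Sg Δ → SCheck Sg (skelCtx Δ) N ρ →
      HeadTy Θ H A → HeadTy Δ H' A' →
      SWf Sg (skelCtx Θ) (atom a S) → SWf Sg (skelCtx Δ) (atom a S₁) →
      SubSp τ N k T T' → SubTy τ N k A A' → SpTy Θ T A P → SubTy τ N k (atom a S) (atom a S₁) →
      TyEq Sg P (atom a S) → Check Δ (H' · T') (atom a S₁)
    Head-sub τ s θ δ n h h' w v d b t a e with SpTy-sub τ s θ δ n (HeadTy-wf θ h) (HeadTy-wf δ h') d b t
    ... | _ , w' , _ , b' , t' = catom (shd h' t') (TyEq-sub-simple n w' w e b' a)

    SpTy-sub : ∀ τ → Sub τ N k Θ Δ → SWfCtx Sg Θ → SWfCtx Sg Δ → SCheck Sg (skelCtx Δ) N ρ →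
      SWf Sg (skelCtx Θ) A → SWf Sg (skelCtx Δ) A' → SubSp τ N k S S' → SubTy τ N k A A' →
      SpTy Θ S A P →
      ∃[ P' ] (SWf Sg (skelCtx Θ) P × SWf Sg (skelCtx Δ) P' × SubTy τ N k P P' × SpTy Δ S' A' P')
    SpTy-sub τ s θ δ n w v ε (atom a) snil = _ , w , v , atom a , snil
    SpTy-sub τ s θ δ n (Πt w₂ w₁) (Πt v₂ v₁) (d ∷ ds) (Πt {A = A₂'} a₂ a₁) (scons {M} {A₂ = A₂} c p t)
      with Check-sub τ s θ δ n w₂ v₂ d a₂ c | SubTy₀-exchange d (substTy₀-sound p) a₁
    ... | c' | C , b , b'
      -- By exchange, `C` is both the substituted instance of the old codomain and the instance of
      -- the new codomain. The latter is annotated with the erasure of the old domain, which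
      -- substitution preserves.
      with b'' ← subst (λ τ → SubTy τ _ 0 _ C) (skel-erase (skel-SubTy a₂)) b'
      with SpTy-sub τ s θ δ n (SWf-scons c w₁ (substTy₀-sound p)) (SWf-scons c' v₁ b'') ds b t
    ...   | P' , w' , v' , a' , t' = P' , w' , v' , a' , scons c' (substTy₀-complete b'') t'
    SpTy-sub {N = N} {k} τ s θ δ n (Πp w₂ w₁) (Πp v₂ v₁) ([_]∷_ {i = i} p ds) (Πp {A' = A₁'} a₂ a₁) (spre {y} {A₁ = A₁} x e t) with s x
    ... | inj₁ (_ , _ , _ , () , _)
    ... | inj₂ (_ , _ , q , pre {A = B} {A' = B'} b , z) with Ins-injective p q
    ...   | refl
      with e' ← TyEq-sub-simple n (θ x) w₂ e b a₂
      with SpTy-sub τ s θ δ n (SWf-spre x e w₁) (SWf-spre z e' v₁) ds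
        (subst (λ A → SubTy τ N k A (renTy i 0 A₁')) (sym (renTy-inst y A₁))
          (subst (SubTy τ N k _) (sym (renTy-inst i A₁')) (SubTy-inst p a₁))) t
    ...     | P' , w' , v' , a' , t' = P' , w' , v' , a' , spre z e' t'

    -- The annotation is fixed by the reduction, whereas `A` is instantiated argument by argument,
    -- so the two are linked by an equation that each instantiation preserves.
    Check-reduce : ∀ τ → erase A ≡ τ → SWfCtx Sg Δ → SWf Sg (skelCtx Δ) A →
      Check Δ R A → SpTy Δ S A P → Red τ S R R' → Check Δ R' P
    Check-reduce * p δ w c snil ε = c
    Check-reduce (σ ⇒ τ) p δ (Πt w₂ w₁) (clam c) (scons n q t) (d ∷ r)
      with ⇒-injective p | substTy₀-sound q
    ... | p₂ , p₁ | a with w' ← SWf-scons n w₁ a =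
      Check-reduce τ (trans (skel-erase (sym (skel-SubTy a))) p₁) δ w'
        (Check-sub σ (Sub-zero p₂ w₂ n) (SWfCtx-∷ δ w₂) δ (Check-simple n) w₁ w' d
          (subst (λ σ → SubTy σ _ 0 _ _) p₂ a) c) t r
    Check-reduce (* ⇒ τ) p δ (Πp w₂ w₁) (clamp {A₁ = A₁} c) (spre x e t) ([ y ]∷ r)
      with w' ← SWf-spre x e w₁ =
      Check-reduce τ (trans (skel-erase (skel-ren y 0 A₁)) (proj₂ (⇒-injective p))) δ w'
        (Check-rename (Ren-inst δ x e) (SWfCtx-∷ δ w₂) δ w₁ w'
          (subst (λ A → TyEq Sg A (renTy y 0 A₁)) (renTy-inst y A₁) (TyEq-refl w')) c) t r

  -- Substitution in contexts and the final assembly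

  substEntry-defined : SSub k (skel A) Φ Ψ → SCheck Sg Ψ (shiftTm 0 k N) (skel A) →
    ∀ e → SWf Sg Φ (entryTy e) →
    ∃[ e' ] (substEntry (erase A) N k e ≡ just e' × SubEntry (erase A) (shiftTm 0 k N) k e e' × SWf Sg Ψ (entryTy e'))
  substEntry-defined {A = A} {N = N} s n (ord B) w with SWf-sub-erase A s n w
  ... | _ , d , v = _ , cong (map ord) (substTy-complete N refl d) , ord d , v
  substEntry-defined {A = A} {N = N} s n (pre B) w with SWf-sub-erase A s n w
  ... | _ , d , v = _ , cong (map pre) (substTy-complete N refl d) , pre d , v

  skelEntry-SubEntry : SubEntry τ N k e e' → skelEntry e ≡ skelEntry e'
  skelEntry-SubEntry (ord d) = cong ord (skel-SubTy d)
  skelEntry-SubEntry (pre d) = cong pre (skel-SubTy d)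

  -- Here the two conventions for the substituend meet: `N` belongs to the context outside the `k`
  -- later entries, and its shift by `k` to the whole context `Δ`.
  record Substituted (A : Ty) (N : Tm) (k : ℕ) (Θ Δ : Ctx) : Set where
    field
      sub    : Sub (erase A) (shiftTm 0 k N) k Θ Δ
      ssub   : SSub k (skel A) (skelCtx Θ) (skelCtx Δ)
      simple : SCheck Sg (skelCtx Δ) (shiftTm 0 k N) (skel A)
      wf     : SWfCtx Sg Δ
  open Substituted

  substCtx-defined : ∀ Γ' → WfCtx (Γ' ++ ord A ∷ Γ) → Check Γ N A →
    ∃[ Γ'' ] (substCtx (erase A) N Γ' ≡ just Γ'' × Substituted A N (length Γ') (Γ' ++ ord A ∷ Γ) (Γ'' ++ Γ))
  substCtx-defined {A} {Γ} {N} [] (ccons γ w) c = [] , refl , record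
    { sub    = Sub-zero refl (WfTy-simple w) c₀
    ; ssub   = SSub-zero
    ; simple = Check-simple c₀
    ; wf     = WfCtx-simple γ
    }
    where
    c₀ : Check Γ (shiftTm 0 0 N) A
    c₀ = subst (λ L → Check Γ L A) (sym (shiftTm-zero N)) c
  substCtx-defined {A} {Γ} {N} (e ∷ Γ') (ccons γ w) c with substCtx-defined Γ' γ c
  ... | Γ'' , p , s with substEntry-defined {A = A} {N = N} (ssub s) (simple s) e (WfTy-simple w)
  ...   | e' , q , d , v = e' ∷ Γ'' , substCtx≡ , record
    { sub    = subst (λ L → Sub (erase A) L (suc (length Γ')) (e ∷ Γ' ++ ord A ∷ Γ) (e' ∷ Γ'' ++ Γ)) (renameTm-shift (length Γ') N)
        (Sub-suc (wf s) v d (sub s))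
    ; ssub   = subst (λ η → SSub (suc (length Γ')) (skel A) (skelEntry e ∷ _) (η ∷ _)) (skelEntry-SubEntry d) (SSub-suc (ssub s))
    ; simple = subst (λ L → SCheck Sg _ L (skel A)) (renameTm-shift (length Γ') N) (SCheck-rename there (simple s))
    ; wf     = SWfCtx-∷ (wf s) v
    }
    where
    substCtx≡ : substCtx (erase A) N (e ∷ Γ') ≡ just (e' ∷ Γ'')
    substCtx≡ rewrite q | p = refl

  subst-typed : ∀ Γ' {B} → WfCtx (Γ' ++ ord A ∷ Γ) → WfTy (Γ' ++ ord A ∷ Γ) B →
    Check Γ N A → Check (Γ' ++ ord A ∷ Γ) M B →
    ∃[ Γ'' ] ∃[ M' ] ∃[ B' ]
      (substCtx (erase A) N Γ' ≡ just Γ'' ×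
       substTm (erase A) N (length Γ') M ≡ just M' ×
       substTy (erase A) N (length Γ') B ≡ just B' ×
       Check (Γ'' ++ Γ) M' B')
  subst-typed {A} {N = N} Γ' γ w n c
    with Γ'' , q , s ← substCtx-defined Γ' γ n
    with M' , d , _ ← SCheck-sub-erase A (ssub s) (simple s) (Check-simple c)
    with B' , b , v ← SWf-sub-erase A (ssub s) (simple s) (WfTy-simple w) =
    Γ'' , M' , B' , q , substTm-complete N refl d , substTy-complete N refl b ,
    Check-sub (erase A) (sub s) (WfCtx-simple γ) (wf s) (simple s) (WfTy-simple w) v d b c

theorem4 : (Sg : Sig) → SigOK Sg → (Ξ rest : Sig) → Sg ≡ Ξ ++ rest → (m : Mode) →
    (Γ Γ' : Ctx) (N M : Tm) (A B : Ty) →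
    Typing.WfCtx m Ξ Sg (Γ' ++ ord A ∷ Γ) →
    Typing.WfTy m Ξ Sg (Γ' ++ ord A ∷ Γ) B →
    Typing.Check m Ξ Sg Γ N A →
    Typing.Check m Ξ Sg (Γ' ++ ord A ∷ Γ) M B →
    ∃[ Γ'' ] ∃[ M' ] ∃[ B' ]
    (substCtx (erase A) N Γ' ≡ just Γ'' ×
    substTm (erase A) N (length Γ') M ≡ just M' ×
    substTy (erase A) N (length Γ') B ≡ just B' ×
    Typing.Check m Ξ Sg (Γ'' ++ Γ) M' B')
theorem4 Sg ok Ξ rest p m Γ Γ' N M A B =
  Substitution.subst-typed m Ξ Sg (λ x → subst (_ ∈_) (sym p) (∈-++⁺ˡ x)) (SigOK-simple ok) Γ'
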